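{- There exist constants $c>1$ and $\Delta_0$ such that for all integers $\Delta\geq\Delta_0$, $n\geq \Delta$ and $H\geq 2$ there exists a graded digraph $G$ with maximum degree $\Delta$ and with a graded partition $V(G)=V_1\cup\dots\cup V_H$ such that $|V_i|\leq n$ for all $i\in[H]$, and such that $\vec r(G) > c^\Delta H n \geq c^\Delta |V(G)|$.
   Context: A digraph $G$ is graded with graded partition $V(G)=V_1\cup\dots\cup V_H$ if every edge of $G$ is directed from $V_i$ to $V_{i+1}$ for some $i\in[H-1]$. The maximum degree of a digraph is the maximum degree of its underlying undirected graph. A tournament is an orientation of a complete graph; for an acyclic digraph $G$, $\vec r(G)$ is the smallest $N$ such that every tournament on $N$ vertices contains a copy of $G$. -}

module Defs where

open import Data.Nat using (ℕ; zero; suc; _≤_)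
open import Data.Bool using (Bool; true; false; _∨_; if_then_else_)
open import Data.Fin using (Fin; toℕ)
open import Data.Fin.Properties using (_≟_)
open import Data.Product using (Σ; ∃; _×_; _,_)
open import Relation.Binary.PropositionalEquality using (_≡_; _≢_)
open import Relation.Nullary using (¬_; yes; no)
open import Function.Definitions using (Injective)
open import Data.Integer using (+_)
import Data.Rational as ℚ
open ℚ using (ℚ; 1ℚ)

count : (m : ℕ) → (Fin m → Bool) → ℕ
count zero    p = 0
count (suc m) p = (if p Fin.zero then 1 else 0) Data.Nat.+ count m (λ i → p (Fin.suc i))
  where import Data.Fin as Fin; import Data.Nat

record Digraph : Set where
  constructor mkDigraph
  field
    size : ℕ
    edge : Fin size → Fin size → Bool
open Digraph public

degree : (G : Digraph) → Fin (size G) → ℕ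
degree G v = count (size G) (λ u → edge G u v ∨ edge G v u)

MaxDegree : Digraph → ℕ → Set
MaxDegree G Δ = (∀ v → degree G v ≤ Δ) × (∃ λ v → degree G v ≡ Δ)

IsGradedPartition : (G : Digraph) (H : ℕ) → (Fin (size G) → Fin H) → Set
IsGradedPartition G H lvl =
  ∀ u v → edge G u v ≡ true → toℕ (lvl v) ≡ suc (toℕ (lvl u))

partSize : (G : Digraph) {H : ℕ} → (Fin (size G) → Fin H) → Fin H → ℕ
partSize G lvl i = count (size G) (λ v → does (lvl v ≟ i))
  where open import Relation.Nullary using (does)

IsTournament : (N : ℕ) → (Fin N → Fin N → Bool) → Set
IsTournament N T = ∀ i j → i ≢ j → ¬ (T i j ≡ T j i)

ContainsCopy : (N : ℕ) → (Fin N → Fin N → Bool) → Digraph → Set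
ContainsCopy N T G =
  Σ (Fin (size G) → Fin N) λ f →
    Injective _≡_ _≡_ f × (∀ u v → edge G u v ≡ true → T (f u) (f v) ≡ true)

Forces : Digraph → ℕ → Set
Forces G N = ∀ T → IsTournament N T → ContainsCopy N T G

-- r⃗(G) > K : the smallest N forcing G exceeds K, i.e. no N ≤ K forces G
RamseyGreater : Digraph → ℚ → Set
RamseyGreater G K = ∀ (N : ℕ) → (+ N ℚ./ 1) ℚ.≤ K → ¬ Forces G N

ℕtoℚ : ℕ → ℚ
ℕtoℚ n = + n ℚ./ 1

_^ℚ_ : ℚ → ℕ → ℚ
c ^ℚ zero  = 1ℚ
c ^ℚ suc k = c ℚ.* (c ^ℚ k)

{-# OPTIONS --safe #-}

-- Levels are joined by the same sparse pseudorandom bipartite graph, with vertices of large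
-- degree isolated. The tournament is a transitive sequence of about H / 4 blocks. Inside a
-- block, the vertices are grouped into k consecutive slots of t vertices, and an arc points
-- forward or backward according to a random k × k matrix indexed by slots, where k is
-- exponential in Δ. In a copy of the graph, every large set of vertices of a level sends
-- an edge to every large set of vertices of the next level, so the blocks containing the
-- quartiles of the levels increase along the levels. As there are few blocks, the second and
-- third quarters of some two consecutive levels lie in a single block, with one of the quarters
-- of the lower level entirely before or after a quarter of the upper one. Between such sets a
-- constant proportion of the arcs points the wrong way, and the graph meets every
-- configuration (assignment of slots) with that property. Both random objects are found by the
-- method of conditional expectations.
module Submission where

open import Defs
open import Data.Bool using (Bool; T; true; false; not; _∧_; _∨_; if_then_else_)
open import Data.Bool.Properties using (∨-zeroʳ; ∨-identityʳ; not-involutive; not-¬)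
open import Data.Empty using (⊥)
open import Data.Fin using (Fin; zero; suc; toℕ; fromℕ<; combine; remQuot; _↑ˡ_; _↑ʳ_; finToFun; funToFin)
open import Data.Fin.Properties using (_≟_; suc-injective; remQuot-combine; toℕ-combine; combine-injectiveʳ; combine-monoˡ-<; finToFun-funToFin; all?; any?; toℕ-injective; toℕ<n; toℕ-fromℕ<)
open import Data.Integer using () renaming (+_ to pos)
import Data.Integer as ℤ
import Data.Integer.Properties as ℤ
open import Data.Nat hiding (_≟_)
open import Data.Nat.DivMod
open import Data.Nat.Properties renaming (_≟_ to _ℕ≟_; suc-injective to ℕ-suc-injective)
open import Algebra.Properties.CommutativeMonoid.Sum *-1-commutativeMonoid using () renaming (sum to product; ∑-distrib-+ to product-distrib-*)
open import Algebra.Properties.Semiring.Sum +-*-semiring using (sum; sum-cong-≗; ∑-distrib-+; ∑-comm; *-distribˡ-sum; *-distribʳ-sum)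
open import Data.Nat.Tactic.RingSolver using (solve-∀)
open import Data.Product using (Σ; ∃; _×_; _,_; proj₁; proj₂)
open import Data.Rational using (ℚ; 1ℚ) renaming (_<_ to _<ℚ_; _*_ to _*ℚ_; _≤_ to _≤ℚ_)
import Data.Rational as ℚ
import Data.Rational.Properties as ℚ
import Data.Rational.Unnormalised as ℚᵘ
import Data.Rational.Unnormalised.Properties as ℚᵘ
open import Data.Sum using (_⊎_; inj₁; inj₂)
open import Data.Unit using (tt)
open import Function using (_∘_; id)
open import Function.Definitions using (Injective)
open import Relation.Binary.Definitions using (tri<; tri≈; tri>)
open import Relation.Binary.PropositionalEquality
open import Relation.Nullary using (Dec; ¬_; yes; no; does; contradiction)
open import Relation.Nullary.Decidable using (dec-true; _×-dec_)


-- Finite sums and products, and counting by indicators.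

ind : Bool → ℕ
ind true  = 1
ind false = 0

count≡sum : ∀ {n} (p : Fin n → Bool) → count n p ≡ sum (ind ∘ p)
count≡sum {zero}  p = refl
count≡sum {suc n} p = cong₂ _+_ (lemma (p zero)) (count≡sum (p ∘ suc))
  where
  lemma : ∀ b → (if b then 1 else 0) ≡ ind b
  lemma true  = refl
  lemma false = refl

sum-mono-≤ : ∀ {n} {f g : Fin n → ℕ} → (∀ i → f i ≤ g i) → sum f ≤ sum g
sum-mono-≤ {zero}  le = z≤n
sum-mono-≤ {suc n} le = +-mono-≤ (le zero) (sum-mono-≤ (le ∘ suc))

term≤sum : ∀ {n} (f : Fin n → ℕ) i → f i ≤ sum f
term≤sum f zero    = m≤m+n _ _
term≤sum f (suc i) = ≤-trans (term≤sum (f ∘ suc) i) (m≤n+m _ _)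

sum-const : ∀ n x → sum {n} (λ _ → x) ≡ n * x
sum-const zero    x = refl
sum-const (suc n) x = cong (x +_) (sum-const n x)

sum-zero : ∀ {n} {f : Fin n → ℕ} → (∀ i → f i ≡ 0) → sum f ≡ 0
sum-zero {n} f≡0 = trans (sum-cong-≗ f≡0) (trans (sum-const n 0) (*-zeroʳ n))

product-mono-≤ : ∀ {n} {f g : Fin n → ℕ} → (∀ i → f i ≤ g i) → product f ≤ product g
product-mono-≤ {zero}  le = ≤-refl
product-mono-≤ {suc n} le = *-mono-≤ (le zero) (product-mono-≤ (le ∘ suc))

product-const : ∀ n x → product {n} (λ _ → x) ≡ x ^ n
product-const zero    x = refl
product-const (suc n) x = cong (x *_) (product-const n x)

product-^ : ∀ {n} x (f : Fin n → ℕ) → product (λ i → x ^ f i) ≡ x ^ sum f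
product-^ {zero}  x f = refl
product-^ {suc n} x f = trans (cong (x ^ f zero *_) (product-^ x (f ∘ suc)))
                              (sym (^-distribˡ-+-* x (f zero) (sum (f ∘ suc))))

product≡0 : ∀ {n} (f : Fin n → ℕ) → product f ≡ 0 → ∃ λ i → f i ≡ 0
product≡0 {suc n} f eq with m*n≡0⇒m≡0∨n≡0 (f zero) eq
... | inj₁ z = zero , z
... | inj₂ z with product≡0 (f ∘ suc) z
...   | i , fi≡0 = suc i , fi≡0

sum-combine : ∀ m {n} (f : Fin (m * n) → ℕ) → sum f ≡ sum {m} λ i → sum {n} λ j → f (combine i j)
sum-combine zero        f = refl
sum-combine (suc m) {n} f = trans (sum-+ n f) (cong (sum (f ∘ (_↑ˡ (m * n))) +_) (sum-combine m (f ∘ (n ↑ʳ_))))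
  where
  sum-+ : ∀ a {b} (f : Fin (a + b) → ℕ) → sum f ≡ sum (f ∘ (_↑ˡ b)) + sum (f ∘ (a ↑ʳ_))
  sum-+ zero    f = refl
  sum-+ (suc a) f = trans (cong (f zero +_) (sum-+ a (f ∘ suc))) (sym (+-assoc (f zero) _ _))

sum-remQuot : ∀ m n (f : Fin m → Fin n → ℕ) →
  sum {m * n} (λ x → f (proj₁ (remQuot {m} n x)) (proj₂ (remQuot {m} n x))) ≡ sum {m} λ i → sum {n} (f i)
sum-remQuot m n f = trans (sum-combine m {n} _) (sum-cong-≗ {m} λ i → sum-cong-≗ {n} λ j →
  cong₂ f (cong proj₁ (remQuot-combine i j)) (cong proj₂ (remQuot-combine i j)))

sum-*-sum : ∀ {m n} (f : Fin m → ℕ) (g : Fin n → ℕ) → (sum λ i → sum λ j → f i * g j) ≡ sum f * sum g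
sum-*-sum f g = trans (sum-cong-≗ λ i → sym (*-distribˡ-sum (f i) g)) (sym (*-distribʳ-sum (sum g) f))

δ : ∀ {n} → Fin n → Fin n → ℕ
δ i j = ind (does (i ≟ j))

sum-≤1 : ∀ {n} (p : Fin n → Bool) → (∀ i j → p i ≡ true → p j ≡ true → i ≡ j) → sum (ind ∘ p) ≤ 1
sum-≤1 {zero}  p unique = z≤n
sum-≤1 {suc n} p unique with p zero in eq
... | false = sum-≤1 (p ∘ suc) λ i j pi pj → suc-injective (unique (suc i) (suc j) pi pj)
... | true  = s≤s (≤-reflexive (sum-zero rest))
  where
  rest : ∀ i → ind (p (suc i)) ≡ 0
  rest i with p (suc i) in eqi
  ... | false = refl
  ... | true  = contradiction (unique zero (suc i) eq eqi) λ ()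

does-≟ : ∀ {n} {i j : Fin n} → does (i ≟ j) ≡ true → i ≡ j
does-≟ {i = i} {j} eq with i ≟ j
... | yes i≡j = i≡j

sum-δ-injective : ∀ {m n} (σ : Fin m → Fin n) → Injective _≡_ _≡_ σ → ∀ u → (sum λ i → δ (σ i) u) ≤ 1
sum-δ-injective σ inj u = sum-≤1 _ λ i j p q → inj (trans (does-≟ p) (sym (does-≟ q)))

sum-δ : ∀ {n} (a : Fin n) (f : Fin n → ℕ) → (sum λ u → δ a u * f u) ≡ f a
sum-δ {suc n} zero    f = trans (cong (f zero + 0 +_) (sum-zero {n} λ _ → refl)) (trans (+-identityʳ _) (+-identityʳ _))
sum-δ {suc n} (suc a) f = trans (sum-cong-≗ (λ i → cong (_* f (suc i)) (δ-suc a i))) (sum-δ a (f ∘ suc))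
  where
  δ-suc : ∀ {n} (i j : Fin n) → δ (suc i) (suc j) ≡ δ i j
  δ-suc i j with i ≟ j
  ... | yes _ = refl
  ... | no  _ = refl

sum-δ-1 : ∀ {n} (a : Fin n) → sum (δ a) ≡ 1
sum-δ-1 a = trans (sum-cong-≗ λ u → sym (*-identityʳ (δ a u))) (sum-δ a (λ _ → 1))

-- Double counting: the indices `i` are grouped by their value `σ i`.
sum-fibres : ∀ {m n} (σ : Fin m → Fin n) (f : Fin n → ℕ) → (sum λ u → (sum λ i → δ (σ i) u) * f u) ≡ sum (f ∘ σ)
sum-fibres {m} {n} σ f = begin
  (sum λ u → (sum λ i → δ (σ i) u) * f u) ≡⟨ sum-cong-≗ (λ u → *-distribʳ-sum (f u) (λ i → δ (σ i) u)) ⟩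
  (sum λ u → sum λ i → δ (σ i) u * f u)   ≡⟨ ∑-comm {m} {n} _ ⟨
  (sum λ i → sum λ u → δ (σ i) u * f u)   ≡⟨ sum-cong-≗ (λ i → sum-δ (σ i) f) ⟩
  (sum λ i → f (σ i))                     ∎
  where open ≡-Reasoning

sum-∘-injective-≤ : ∀ {m n} (σ : Fin m → Fin n) → Injective _≡_ _≡_ σ → (f : Fin n → ℕ) → sum (f ∘ σ) ≤ sum f
sum-∘-injective-≤ σ inj f = begin
  sum (f ∘ σ)                             ≡⟨ sum-fibres σ f ⟨
  (sum λ u → (sum λ i → δ (σ i) u) * f u) ≤⟨ sum-mono-≤ (λ u → *-monoˡ-≤ (f u) (sum-δ-injective σ inj u)) ⟩
  (sum λ u → 1 * f u)                     ≡⟨ sum-cong-≗ (λ u → *-identityˡ (f u)) ⟩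
  sum f                                   ∎
  where open ≤-Reasoning

-- Minima, averages and the method of conditional expectations.

minimiser : ∀ {n} (p : Fin n → Bool) (f : Fin n → ℕ) →
  (∀ i → p i ≡ false) ⊎ ∃ λ i → p i ≡ true × (∀ j → p j ≡ true → f i ≤ f j)
minimiser {zero}  p f = inj₁ λ ()
minimiser {suc n} p f with p zero in eq | minimiser (p ∘ suc) (f ∘ suc)
... | false | inj₁ none = inj₁ λ { zero → eq ; (suc i) → none i }
... | false | inj₂ (i , pi , min) = inj₂ (suc i , pi , λ
  { zero pj → contradiction (trans (sym eq) pj) (λ ()) ; (suc j) pj → min j pj })
... | true | inj₁ none = inj₂ (zero , eq , λ
  { zero _ → ≤-refl ; (suc j) pj → contradiction (trans (sym (none j)) pj) (λ ()) })
... | true | inj₂ (i , pi , min) with ≤-total (f zero) (f (suc i))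
...   | inj₁ le = inj₂ (zero , eq , λ { zero _ → ≤-refl ; (suc j) pj → ≤-trans le (min j pj) })
...   | inj₂ ge = inj₂ (suc i , pi , λ { zero _ → ge ; (suc j) pj → min j pj })

-- The minimum of `f` is at most its mean.
average : ∀ {P} .{{_ : NonZero P}} (f : Fin P → ℕ) → ∃ λ x → P * f x ≤ sum f
average {suc P} f with minimiser (λ _ → true) f
... | inj₁ none = contradiction (none zero) λ ()
... | inj₂ (x , _ , min) = x , ≤-trans (≤-reflexive (sym (sum-const (suc P) (f x)))) (sum-mono-≤ λ y → min y refl)

-- The right-hand side is P ^ m times the mean of the total weight over all sequences g.
conditional-expectations : ∀ {P T} .{{_ : NonZero P}} m (v : Fin T → ℕ) (w : Fin m → Fin T → Fin P → ℕ) →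
  ∃ λ (g : Fin m → Fin P) →
    P ^ m * (sum λ τ → v τ * product λ i → w i τ (g i)) ≤ sum λ τ → v τ * product λ i → sum (w i τ)
conditional-expectations zero v w = (λ ()) , ≤-reflexive (+-identityʳ _)
conditional-expectations {P} {T} (suc m) v w = g , (begin
  P ^ suc m * sum (λ τ → v τ * (w zero τ x * product λ i → w (suc i) τ (g′ i)))
    ≡⟨ cong (P ^ suc m *_) (sum-cong-≗ λ τ → sym (*-assoc (v τ) (w zero τ x) _)) ⟩
  P ^ suc m * sum (λ τ → v τ * w zero τ x * product λ i → w (suc i) τ (g′ i))
    ≡⟨ *-assoc P (P ^ m) _ ⟩
  P * (P ^ m * sum (λ τ → v τ * w zero τ x * product λ i → w (suc i) τ (g′ i)))
    ≤⟨ *-monoʳ-≤ P le ⟩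
  P * F x
    ≤⟨ Fx≤ ⟩
  sum F
    ≡⟨ ∑-comm {P} {T} _ ⟩
  sum (λ τ → sum λ y → v τ * w zero τ y * S τ)
    ≡⟨ sum-cong-≗ (λ τ → trans (sum-cong-≗ λ y → *-assoc (v τ) (w zero τ y) (S τ))
         (trans (sym (*-distribˡ-sum (v τ) λ y → w zero τ y * S τ))
                (cong (v τ *_) (sym (*-distribʳ-sum (S τ) (w zero τ)))))) ⟩
  sum (λ τ → v τ * (sum (w zero τ) * S τ)) ∎)
  where
  open ≤-Reasoning
  S : Fin T → ℕ
  S τ = product λ i → sum (w (suc i) τ)
  -- `F y` is, up to the factor `P ^ m`, the conditional mean once the first coordinate is `y`; the
  -- later coordinates are averaged out in `S`.
  F : Fin P → ℕ
  F y = sum λ τ → v τ * w zero τ y * S τ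
  x = proj₁ (average F)
  Fx≤ = proj₂ (average F)
  -- The factor of the coordinate just fixed is absorbed into the weights, which is why the
  -- statement carries a general `v`.
  rest = conditional-expectations m (λ τ → v τ * w zero τ x) (λ i → w (suc i))
  g′ = proj₁ rest
  le = proj₂ rest
  g : Fin (suc m) → Fin P
  g zero    = x
  g (suc i) = g′ i

ind-≤1 : ∀ b → ind b ≤ 1
ind-≤1 true  = ≤-refl
ind-≤1 false = z≤n

ind-+-not : ∀ b → ind b + ind (not b) ≡ 1
ind-+-not true  = refl
ind-+-not false = refl

sum-ind-+-not : ∀ {n} (p : Fin n → Bool) → sum (ind ∘ p) + sum (ind ∘ not ∘ p) ≡ n
sum-ind-+-not {n} p = begin
  sum (ind ∘ p) + sum (ind ∘ not ∘ p)      ≡⟨ ∑-distrib-+ (ind ∘ p) (ind ∘ not ∘ p) ⟨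
  (sum λ x → ind (p x) + ind (not (p x)))  ≡⟨ sum-cong-≗ (λ x → ind-+-not (p x)) ⟩
  (sum {n} λ _ → 1)                        ≡⟨ sum-const n 1 ⟩
  n * 1                                    ≡⟨ *-identityʳ n ⟩
  n                                        ∎
  where open ≡-Reasoning

-- Serves to bound a weighted sum term by term: where the indicator is zero the term vanishes, so
-- the estimate is needed only under `A`.
ind-does-≤ : ∀ {A : Set} (d : Dec A) x y z → (A → x * y ≤ z) → ind (does d) * x * y ≤ z
ind-does-≤ (no _)  x y z le = z≤n
ind-does-≤ (yes a) x y z le = ≤-trans (≤-reflexive (cong (_* y) (*-identityˡ x))) (le a)

^-swap : ∀ a b m → (a * b) ^ m ≡ b ^ m * a ^ m
^-swap a b zero    = refl
^-swap a b (suc m) = trans (cong (a * b *_) (^-swap a b m)) (lemma a b (b ^ m) (a ^ m))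
  where
  lemma : ∀ a b c d → a * b * (c * d) ≡ b * c * (a * d)
  lemma = solve-∀

-- A random point misses a set of density at least 1 / (1 + γ) with probability at most γ / (1 + γ).
hitting-points : ∀ {P T} .{{_ : NonZero P}} m γ (W : Fin T → Fin P → Bool) → T * γ ^ m < suc γ ^ m →
  ∃ λ (g : Fin m → Fin P) → ∀ τ → P ≤ suc γ * sum (ind ∘ W τ) → ∃ λ i → W τ (g i) ≡ true
hitting-points {P} {T} m γ W few = g , hit
  where
  dense? = λ τ → P ≤? suc γ * sum (ind ∘ W τ)
  -- Sets below the required density get weight zero, so the weighted sum counts only the dense sets
  -- that are missed.
  v : Fin T → ℕ
  v τ = ind (does (dense? τ))
  miss : Fin T → Fin P → ℕ
  miss τ = ind ∘ not ∘ W τ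
  chosen = conditional-expectations m v (λ _ → miss)
  g = proj₁ chosen
  Φ = sum λ τ → v τ * product λ i → miss τ (g i)

  miss-bound : ∀ τ → P ≤ suc γ * sum (ind ∘ W τ) → suc γ * sum (miss τ) ≤ γ * P
  miss-bound τ dense = +-cancelʳ-≤ P _ _ (begin
    suc γ * sum (miss τ) + P                          ≤⟨ +-monoʳ-≤ (suc γ * sum (miss τ)) dense ⟩
    suc γ * sum (miss τ) + suc γ * sum (ind ∘ W τ)    ≡⟨ *-distribˡ-+ (suc γ) (sum (miss τ)) _ ⟨
    suc γ * (sum (miss τ) + sum (ind ∘ W τ))          ≡⟨ cong (suc γ *_) (trans (+-comm (sum (miss τ)) _) (sum-ind-+-not (W τ))) ⟩
    P + γ * P                                         ≡⟨ +-comm P (γ * P) ⟩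
    γ * P + P                                         ∎)
    where open ≤-Reasoning

  term-bound : ∀ τ → v τ * product {m} (λ i → sum (miss τ)) * suc γ ^ m ≤ P ^ m * γ ^ m
  term-bound τ = ind-does-≤ (dense? τ) _ _ _ λ dense → begin
    product {m} (λ i → sum (miss τ)) * suc γ ^ m       ≡⟨ cong (_* suc γ ^ m) (product-const m (sum (miss τ))) ⟩
    sum (miss τ) ^ m * suc γ ^ m                       ≡⟨ ^-swap (suc γ) (sum (miss τ)) m ⟨
    (suc γ * sum (miss τ)) ^ m                         ≤⟨ ^-monoˡ-≤ m (miss-bound τ dense) ⟩
    (γ * P) ^ m                                        ≡⟨ ^-swap γ P m ⟩
    P ^ m * γ ^ m                                      ∎
    where open ≤-Reasoning

  -- `Φ` is the number of dense sets missed by `g`. Its bound by the mean is below 1, so as a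
  -- natural number it vanishes.
  Φ<1 : Φ < 1
  Φ<1 = *-cancelˡ-< (P ^ m * suc γ ^ m) Φ 1 (begin-strict
    P ^ m * suc γ ^ m * Φ   ≡⟨ lemma (P ^ m) (suc γ ^ m) Φ ⟩
    P ^ m * Φ * suc γ ^ m   ≤⟨ *-monoˡ-≤ (suc γ ^ m) (proj₂ chosen) ⟩
    sum (λ τ → v τ * product {m} λ i → sum (miss τ)) * suc γ ^ m ≡⟨ *-distribʳ-sum (suc γ ^ m) (λ τ → v τ * product {m} λ i → sum (miss τ)) ⟩
    sum (λ τ → v τ * product {m} (λ i → sum (miss τ)) * suc γ ^ m) ≤⟨ sum-mono-≤ term-bound ⟩
    sum {T} (λ τ → P ^ m * γ ^ m) ≡⟨ sum-const T _ ⟩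
    T * (P ^ m * γ ^ m)     ≡⟨ lemma′ T (P ^ m) (γ ^ m) ⟩
    P ^ m * (T * γ ^ m)     <⟨ *-monoʳ-< (P ^ m) {{m^n≢0 P m}} few ⟩
    P ^ m * suc γ ^ m       ≡⟨ *-identityʳ _ ⟨
    P ^ m * suc γ ^ m * 1   ∎)
    where
    open ≤-Reasoning
    lemma : ∀ a b c → a * b * c ≡ a * c * b
    lemma = solve-∀
    lemma′ : ∀ a b c → a * (b * c) ≡ b * (a * c)
    lemma′ = solve-∀

  hit : ∀ τ → P ≤ suc γ * sum (ind ∘ W τ) → ∃ λ i → W τ (g i) ≡ true
  hit τ dense = proj₁ missed , lemma (W τ (g (proj₁ missed))) (proj₂ missed)
    where
    vanishes : product (λ i → miss τ (g i)) ≡ 0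
    vanishes = n≤0⇒n≡0 (begin
      product (λ i → miss τ (g i))        ≡⟨ *-identityˡ _ ⟨
      1 * product (λ i → miss τ (g i))    ≡⟨ cong (λ b → ind b * product (λ i → miss τ (g i))) (dec-true (dense? τ) dense) ⟨
      v τ * product (λ i → miss τ (g i))  ≤⟨ term≤sum (λ τ → v τ * product λ i → miss τ (g i)) τ ⟩
      Φ                                   ≤⟨ s≤s⁻¹ Φ<1 ⟩
      0                                   ∎)
      where open ≤-Reasoning
    missed = product≡0 _ vanishes
    lemma : ∀ b → ind (not b) ≡ 0 → b ≡ true
    lemma true _ = refl

-- Tests, and a random matrix balanced on injective sequences.

-- The number of triples of two sequences of length `n` in `Fin k` and one bit. Such a triple is
-- coded as a single index, so that a union bound over all triples becomes a sum over
-- `Fin (tests k n)`.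
tests : ℕ → ℕ → ℕ
tests k n = k ^ n * (k ^ n * 2)

module _ (k n : ℕ) where

  left right : Fin (tests k n) → Fin n → Fin k
  left  τ = finToFun (proj₁ (remQuot {k ^ n} (k ^ n * 2) τ))
  right τ = finToFun (proj₁ (remQuot {k ^ n} 2 (proj₂ (remQuot {k ^ n} (k ^ n * 2) τ))))

  side : Fin (tests k n) → Fin 2
  side τ = proj₂ (remQuot {k ^ n} 2 (proj₂ (remQuot {k ^ n} (k ^ n * 2) τ)))

  encode : (Fin n → Fin k) → (Fin n → Fin k) → Fin 2 → Fin (tests k n)
  encode α β c = combine (funToFin α) (combine (funToFin β) c)

  module _ (α β : Fin n → Fin k) (c : Fin 2) where

    private
      outer : remQuot {k ^ n} (k ^ n * 2) (encode α β c) ≡ (funToFin α , combine (funToFin β) c)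
      outer = remQuot-combine (funToFin α) (combine (funToFin β) c)

      inner : remQuot {k ^ n} 2 (proj₂ (remQuot {k ^ n} (k ^ n * 2) (encode α β c))) ≡ (funToFin β , c)
      inner = trans (cong (remQuot {k ^ n} 2 ∘ proj₂) outer) (remQuot-combine (funToFin β) c)

    left-encode : left (encode α β c) ≗ α
    left-encode i = trans (cong (λ z → finToFun (proj₁ z) i) outer) (finToFun-funToFin α i)

    right-encode : right (encode α β c) ≗ β
    right-encode i = trans (cong (λ z → finToFun (proj₁ z) i) inner) (finToFun-funToFin β i)

    side-encode : side (encode α β c) ≡ c
    side-encode = cong proj₂ inner

code : Bool → Fin 2
code true  = zero
code false = suc zero

agreement : Bool → Bool → ℕ
agreement true  b = ind b
agreement false b = ind (not b)

-- A test is weighted by 2 to the number of its mismatches, whose mean is (3 / 2) ^ (s * s).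
module RandomMatrix (k s T : ℕ) (A B : Fin T → Fin s → Fin k) (C : Fin T → Fin 2) where

  fibre : (Fin s → Fin k) → Fin k → ℕ
  fibre α p = sum λ i → δ (α i) p

  -- Injectivity in terms of fibre sizes: it is decidable in this form and makes every exponent
  -- `e τ p q` at most 1.
  Thin : (Fin s → Fin k) → Set
  Thin α = ∀ p → fibre α p ≤ 1

  mismatch : Fin T → Fin 2 → ℕ
  mismatch τ x = ind (not (does (x ≟ C τ)))

  thin? = λ τ → all? (λ p → fibre (A τ) p ≤? 1) ×-dec all? (λ p → fibre (B τ) p ≤? 1)

  v : Fin T → ℕ
  v τ = ind (does (thin? τ))

  -- The number of times that the test `τ` reads the matrix entry at `(p , q)`.
  e : Fin T → Fin k → Fin k → ℕ
  e τ p q = fibre (A τ) p * fibre (B τ) q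

  cell : Fin (k * k) → Fin k × Fin k
  cell = remQuot {k} k

  w : Fin (k * k) → Fin T → Fin 2 → ℕ
  w i τ x = 2 ^ (e τ (proj₁ (cell i)) (proj₂ (cell i)) * mismatch τ x)

  chosen = conditional-expectations (k * k) v w

  χ : Fin k → Fin k → Fin 2
  χ p q = proj₁ chosen (combine p q)

  mismatches : Fin T → ℕ
  mismatches τ = sum λ i → sum λ j → mismatch τ (χ (A τ i) (B τ j))

  sum-e : ∀ τ (f : Fin k → Fin k → ℕ) →
    sum (λ p → sum λ q → e τ p q * f p q) ≡ sum λ i → sum λ j → f (A τ i) (B τ j)
  sum-e τ f = begin
    sum (λ p → sum λ q → fibre (A τ) p * fibre (B τ) q * f p q)
      ≡⟨ sum-cong-≗ (λ p → trans (sum-cong-≗ λ q → *-assoc (fibre (A τ) p) (fibre (B τ) q) (f p q))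
                                 (sym (*-distribˡ-sum (fibre (A τ) p) λ q → fibre (B τ) q * f p q))) ⟩
    sum (λ p → fibre (A τ) p * sum λ q → fibre (B τ) q * f p q)
      ≡⟨ sum-cong-≗ (λ p → cong (fibre (A τ) p *_) (sum-fibres (B τ) (f p))) ⟩
    sum (λ p → fibre (A τ) p * sum λ j → f p (B τ j))
      ≡⟨ sum-fibres (A τ) (λ p → sum λ j → f p (B τ j)) ⟩
    sum (λ i → sum λ j → f (A τ i) (B τ j)) ∎
    where open ≡-Reasoning

  -- The exponents of 2 add up over the cells, and regrouping the pairs `(i , j)` by the cell they
  -- read gives the number of mismatches.
  weight : ∀ τ → product (λ i → w i τ (proj₁ chosen i)) ≡ 2 ^ mismatches τ
  weight τ = begin
    product (λ i → w i τ (proj₁ chosen i)) ≡⟨ product-^ {k * k} 2 (λ i → e τ (proj₁ (cell i)) (proj₂ (cell i)) * mismatch τ (proj₁ chosen i)) ⟩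
    2 ^ sum (λ i → e τ (proj₁ (cell i)) (proj₂ (cell i)) * mismatch τ (proj₁ chosen i)) ≡⟨ cong (2 ^_) (begin
      sum (λ i → e τ (proj₁ (cell i)) (proj₂ (cell i)) * mismatch τ (proj₁ chosen i))
        ≡⟨ sum-combine k {k} (λ i → e τ (proj₁ (cell i)) (proj₂ (cell i)) * mismatch τ (proj₁ chosen i)) ⟩
      sum (λ p → sum λ q → e τ (proj₁ (cell (combine p q))) (proj₂ (cell (combine p q))) * mismatch τ (χ p q))
        ≡⟨ sum-cong-≗ (λ p → sum-cong-≗ λ q → cong (λ c → e τ (proj₁ c) (proj₂ c) * mismatch τ (χ p q)) (remQuot-combine p q)) ⟩
      sum (λ p → sum λ q → e τ p q * mismatch τ (χ p q))
        ≡⟨ sum-e τ (λ p q → mismatch τ (χ p q)) ⟩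
      mismatches τ ∎) ⟩
    2 ^ mismatches τ ∎
    where open ≡-Reasoning

  -- The two colours of an entry contribute 1 + 1 if it is not read and 1 + 2 if it is read once,
  -- that is, twice `(3 / 2) ^ y`.
  mean-bound : ∀ (c : Fin 2) y → y ≤ 1 → sum (λ x → 2 ^ (y * ind (not (does (x ≟ c))))) * 2 ^ y ≤ 2 * 3 ^ y
  mean-bound zero       zero       _ = ≤-refl
  mean-bound (suc zero) zero       _ = ≤-refl
  mean-bound zero       (suc zero) _ = ≤-refl
  mean-bound (suc zero) (suc zero) _ = ≤-refl
  mean-bound _ (suc (suc _)) (s≤s ())

  means-bound : ∀ τ → v τ * product (λ i → sum (w i τ)) * 2 ^ (s * s) ≤ 2 ^ (k * k) * 3 ^ (s * s)
  means-bound τ = ind-does-≤ (thin? τ) _ _ _ λ (thinA , thinB) → begin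
    product (λ i → sum (w i τ)) * 2 ^ (s * s)
      ≡⟨ cong (λ z → product (λ i → sum (w i τ)) * 2 ^ z) total ⟨
    product (λ i → sum (w i τ)) * 2 ^ sum e′
      ≡⟨ cong (product (λ i → sum (w i τ)) *_) (product-^ 2 e′) ⟨
    product (λ i → sum (w i τ)) * product (λ i → 2 ^ e′ i)
      ≡⟨ product-distrib-* (λ i → sum (w i τ)) (λ i → 2 ^ e′ i) ⟨
    product (λ i → sum (w i τ) * 2 ^ e′ i)
      ≤⟨ product-mono-≤ {k * k} (λ i → mean-bound (C τ) (e′ i) (*-mono-≤ (thinA (proj₁ (cell i))) (thinB (proj₂ (cell i))))) ⟩
    product (λ i → 2 * 3 ^ e′ i)
      ≡⟨ product-distrib-* (λ _ → 2) (λ i → 3 ^ e′ i) ⟩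
    product {k * k} (λ _ → 2) * product (λ i → 3 ^ e′ i)
      ≡⟨ cong₂ _*_ (product-const (k * k) 2) (trans (product-^ 3 e′) (cong (3 ^_) total)) ⟩
    2 ^ (k * k) * 3 ^ (s * s) ∎
    where
    open ≤-Reasoning
    e′ : Fin (k * k) → ℕ
    e′ i = e τ (proj₁ (cell i)) (proj₂ (cell i))
    -- Each of the `s * s` pairs of indices reads exactly one cell.
    total : sum e′ ≡ s * s
    total = trans (sum-remQuot k k (e τ))
      (trans (sum-cong-≗ {k} λ p → sum-cong-≗ {k} λ q → sym (*-identityʳ (e τ p q)))
      (trans (sum-e τ λ _ _ → 1)
      (trans (sum-cong-≗ {s} λ i → trans (sum-const s 1) (*-identityʳ s)) (sum-const s s))))

  -- The weight of one test is at most the total weight, which the choice of the matrix keeps below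
  -- its mean.
  few-mismatches : ∀ τ → Thin (A τ) → Thin (B τ) → 2 ^ mismatches τ * 2 ^ (s * s) ≤ T * 3 ^ (s * s)
  few-mismatches τ thinA thinB = *-cancelˡ-≤ (2 ^ (k * k)) {{m^n≢0 2 (k * k)}} (begin
    2 ^ (k * k) * (2 ^ mismatches τ * 2 ^ (s * s))
      ≡⟨ *-assoc (2 ^ (k * k)) _ _ ⟨
    2 ^ (k * k) * 2 ^ mismatches τ * 2 ^ (s * s)
      ≤⟨ *-monoˡ-≤ (2 ^ (s * s)) (*-monoʳ-≤ (2 ^ (k * k)) single) ⟩
    2 ^ (k * k) * sum (λ τ → v τ * product λ i → w i τ (proj₁ chosen i)) * 2 ^ (s * s)
      ≤⟨ *-monoˡ-≤ (2 ^ (s * s)) (proj₂ chosen) ⟩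
    sum (λ τ → v τ * product λ i → sum (w i τ)) * 2 ^ (s * s)
      ≡⟨ *-distribʳ-sum (2 ^ (s * s)) (λ τ → v τ * product λ i → sum (w i τ)) ⟩
    sum (λ τ → v τ * product (λ i → sum (w i τ)) * 2 ^ (s * s))
      ≤⟨ sum-mono-≤ means-bound ⟩
    sum {T} (λ _ → 2 ^ (k * k) * 3 ^ (s * s))
      ≡⟨ sum-const T _ ⟩
    T * (2 ^ (k * k) * 3 ^ (s * s))
      ≡⟨ lemma T (2 ^ (k * k)) (3 ^ (s * s)) ⟩
    2 ^ (k * k) * (T * 3 ^ (s * s)) ∎)
    where
    open ≤-Reasoning
    lemma : ∀ a b c → a * (b * c) ≡ b * (a * c)
    lemma = solve-∀
    single : 2 ^ mismatches τ ≤ sum λ τ → v τ * product λ i → w i τ (proj₁ chosen i)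
    single = begin
      2 ^ mismatches τ ≡⟨ *-identityˡ _ ⟨
      1 * 2 ^ mismatches τ ≡⟨ cong₂ (λ b → ind b *_) (dec-true (thin? τ) (thinA , thinB)) (weight τ) ⟨
      v τ * product (λ i → w i τ (proj₁ chosen i)) ≤⟨ term≤sum (λ τ → v τ * product λ i → w i τ (proj₁ chosen i)) τ ⟩
      (sum λ τ → v τ * product λ i → w i τ (proj₁ chosen i)) ∎

-- If fewer than a quarter of the entries read agreed with `c`, at least three quarters would be
-- mismatches. The hypothesis, taken with `y` equal to that number, says that the weight of this one
-- test would then exceed the bound on the total weight.
balanced-matrix : ∀ k s → (∀ y → 3 * (s * s) ≤ 4 * y → tests k s * 3 ^ (s * s) < 2 ^ y * 2 ^ (s * s)) →
  ∃ λ (χ : Fin k → Fin k → Bool) → ∀ (α β : Fin s → Fin k) → Injective _≡_ _≡_ α → Injective _≡_ _≡_ β →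
    ∀ c → s * s ≤ 4 * sum λ i → sum λ j → agreement c (χ (α i) (β j))
balanced-matrix k s few = (λ p q → does (R.χ p q ≟ zero)) , balanced
  where
  module R = RandomMatrix k s (tests k s) (left k s) (right k s) (side k s)

  agreement-code : ∀ c (x : Fin 2) → agreement c (does (x ≟ zero)) + ind (not (does (x ≟ code c))) ≡ 1
  agreement-code true  zero       = refl
  agreement-code true  (suc zero) = refl
  agreement-code false zero       = refl
  agreement-code false (suc zero) = refl

  balanced : ∀ α β → Injective _≡_ _≡_ α → Injective _≡_ _≡_ β → ∀ c →
    s * s ≤ 4 * sum λ i → sum λ j → agreement c (does (R.χ (α i) (β j) ≟ zero))
  balanced α β injα injβ c = ≮⇒≥ λ small → <⇒≱
    (few mis (+-cancelˡ-≤ (4 * agr) _ _ (begin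
       4 * agr + 3 * (s * s)   ≤⟨ +-monoˡ-≤ (3 * (s * s)) (<⇒≤ small) ⟩
       s * s + 3 * (s * s)     ≡⟨ cong (λ z → z + 3 * z) total ⟨
       (agr + mis) + 3 * (agr + mis) ≡⟨ lemma agr mis ⟩
       4 * agr + 4 * mis       ∎)))
    (subst (λ z → 2 ^ z * 2 ^ (s * s) ≤ tests k s * 3 ^ (s * s)) mis≡ (R.few-mismatches τ thinα thinβ))
    where
    open ≤-Reasoning
    lemma : ∀ a b → (a + b) + 3 * (a + b) ≡ 4 * a + 4 * b
    lemma = solve-∀
    τ = encode k s α β (code c)
    A≗ = left-encode k s α β (code c)
    B≗ = right-encode k s α β (code c)
    thinα : R.Thin (left k s τ)
    thinα = sum-δ-injective _ (λ {i} {j} eq → injα (trans (sym (A≗ i)) (trans eq (A≗ j))))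
    thinβ : R.Thin (right k s τ)
    thinβ = sum-δ-injective _ (λ {i} {j} eq → injβ (trans (sym (B≗ i)) (trans eq (B≗ j))))
    agr = sum λ i → sum λ j → agreement c (does (R.χ (α i) (β j) ≟ zero))
    mis = sum λ i → sum λ j → ind (not (does (R.χ (α i) (β j) ≟ code c)))
    mis≡ : R.mismatches τ ≡ mis
    mis≡ = sum-cong-≗ λ i → sum-cong-≗ λ j →
      cong₂ (λ x c → ind (not (does (x ≟ c)))) (cong₂ R.χ (A≗ i) (B≗ j)) (side-encode k s α β (code c))
    total : agr + mis ≡ s * s
    total = trans (sym (∑-distrib-+ {s} _ _)) (trans (sum-cong-≗ {s} λ i →
      trans (sym (∑-distrib-+ {s} _ _)) (trans (sum-cong-≗ {s} λ j → agreement-code c (R.χ (α i) (β j)))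
        (trans (sum-const s 1) (*-identityʳ s)))) (sum-const s s))

-- A sparse set of pairs meeting every dense test.

-- An index suc p stands for the node p, and zero for a vertex outside the set under test.
hit : ∀ {k} → (Fin k → Fin k → Bool) → Bool → Fin (suc k) → Fin (suc k) → Bool
hit χ c     zero    _       = false
hit χ c     (suc p) zero    = false
-- A hit is to be a pair whose arc points the wrong way. The bit `true` is meant for a tail placed
-- after its head, where the value `χ q p` reverses the arc; `false` is meant for a tail placed
-- before its head.
hit χ true  (suc p) (suc q) = χ q p
hit χ false (suc p) (suc q) = not (χ p q)

-- Two labellings and a bit determine a subset of `Fin n × Fin n`, namely their hits. Random pairs
-- meet all dense subsets of this kind at once, as there are only `tests (suc k) n` of them.
pseudorandom-edges : ∀ {n k} .{{_ : NonZero n}} m γ (χ : Fin k → Fin k → Bool) →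
  tests (suc k) n * γ ^ m < suc γ ^ m →
  ∃ λ (e : Fin m → Fin n × Fin n) → ∀ (a b : Fin n → Fin (suc k)) c →
    n * n ≤ suc γ * sum (λ u → sum λ v → ind (hit χ c (a u) (b v))) →
    ∃ λ i → hit χ c (a (proj₁ (e i))) (b (proj₂ (e i))) ≡ true
pseudorandom-edges {n} {k} m γ χ few = e , hits
  where
  W : Fin (tests (suc k) n) → Fin (n * n) → Bool
  W τ x = hit χ (does (side (suc k) n τ ≟ zero)) (left (suc k) n τ (proj₁ (remQuot {n} n x))) (right (suc k) n τ (proj₂ (remQuot {n} n x)))
  chosen = hitting-points {{m*n≢0 n n}} m γ W few
  e : Fin m → Fin n × Fin n
  e i = remQuot {n} n (proj₁ chosen i)
  hits : ∀ a b c → n * n ≤ suc γ * sum (λ u → sum λ v → ind (hit χ c (a u) (b v))) →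
    ∃ λ i → hit χ c (a (proj₁ (e i))) (b (proj₂ (e i))) ≡ true
  hits a b c dense = proj₁ found , trans (sym (W≡ (proj₁ chosen (proj₁ found)))) (proj₂ found)
    where
    τ = encode (suc k) n a b (code c)
    decode-code : ∀ c → does (code c ≟ zero) ≡ c
    decode-code true  = refl
    decode-code false = refl
    W≡ : ∀ x → W τ x ≡ hit χ c (a (proj₁ (remQuot {n} n x))) (b (proj₂ (remQuot {n} n x)))
    W≡ x rewrite side-encode (suc k) n a b (code c) | decode-code c
      = cong₂ (hit χ c) (left-encode (suc k) n a b (code c) _) (right-encode (suc k) n a b (code c) _)
    found = proj₂ chosen τ (≤-trans dense (≤-reflexive (cong (suc γ *_)
      (sym (trans (sum-cong-≗ {n * n} (λ x → cong ind (W≡ x))) (sum-remQuot n n λ u v → ind (hit χ c (a u) (b v))))))))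

-- Splitting both sequences along residue classes mod t gives t * t pairs of injective sequences.
balanced-on-transversals : ∀ {k} s t (F : Fin k → Fin k → ℕ) →
  (∀ (α β : Fin s → Fin k) → Injective _≡_ _≡_ α → Injective _≡_ _≡_ β → s * s ≤ 4 * sum λ i → sum λ j → F (α i) (β j)) →
  (α β : Fin (s * t) → Fin k) →
  (∀ ρ → Injective _≡_ _≡_ λ (l : Fin s) → α (combine l ρ)) →
  (∀ ρ → Injective _≡_ _≡_ λ (l : Fin s) → β (combine l ρ)) →
  (s * t) * (s * t) ≤ 4 * sum λ i → sum λ j → F (α i) (β j)
balanced-on-transversals s t F balanced α β injα injβ = begin
  (s * t) * (s * t)                   ≡⟨ lemma s t ⟩
  t * (t * (s * s))                   ≡⟨ trans (sum-cong-≗ {t} λ _ → sum-const t (s * s)) (sum-const t _) ⟨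
  sum {t} (λ _ → sum {t} λ _ → s * s) ≤⟨ sum-mono-≤ {t} (λ ρ → sum-mono-≤ {t} λ σ → balanced _ _ (injα ρ) (injβ σ)) ⟩
  sum (λ ρ → sum λ σ → 4 * part ρ σ)  ≡⟨ sum-cong-≗ {t} (λ ρ → sym (*-distribˡ-sum 4 (part ρ))) ⟩
  sum (λ ρ → 4 * sum (part ρ))        ≡⟨ *-distribˡ-sum 4 (λ ρ → sum (part ρ)) ⟨
  4 * sum (λ ρ → sum (part ρ))        ≡⟨ cong (4 *_) (sum-cong-≗ {t} row) ⟨
  4 * sum (λ ρ → sum {s} λ l → sum λ j → F (α (combine l ρ)) (β j))
                                      ≡⟨ cong (4 *_) (∑-comm {t} {s} _) ⟩
  4 * sum {s} (λ l → sum {t} λ ρ → sum λ j → F (α (combine l ρ)) (β j))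
                                      ≡⟨ cong (4 *_) (sum-combine s {t} (λ i → sum λ j → F (α i) (β j))) ⟨
  4 * sum (λ i → sum λ j → F (α i) (β j)) ∎
  where
  open ≤-Reasoning
  lemma : ∀ s t → (s * t) * (s * t) ≡ t * (t * (s * s))
  lemma = solve-∀
  part : Fin t → Fin t → ℕ
  part ρ σ = sum {s} λ l → sum {s} λ l′ → F (α (combine l ρ)) (β (combine l′ σ))
  row : ∀ ρ → sum {s} (λ l → sum λ j → F (α (combine l ρ)) (β j)) ≡ sum (part ρ)
  row ρ = trans (sum-cong-≗ {s} λ l → trans (sum-combine s {t} λ j → F (α (combine l ρ)) (β j)) (∑-comm {s} {t} _))
                (∑-comm {s} {t} _)

-- Increasing enumerations.

-- Selection sort: the minimiser of `f` on `p` comes first and is removed from `p`. Injectivity of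
-- `f` makes the order strict.
sorted-enumeration : ∀ {n} R (p : Fin n → Bool) (f : Fin n → ℕ) → Injective _≡_ _≡_ f → R ≤ sum (ind ∘ p) →
  ∃ λ (σ : Fin R → Fin n) → (∀ i → p (σ i) ≡ true) × (∀ {i j} → toℕ i < toℕ j → f (σ i) < f (σ j))
sorted-enumeration zero p f inj R≤ = (λ ()) , (λ ()) , λ {}
sorted-enumeration {n} (suc R) p f inj R≤ with minimiser p f
... | inj₁ none = contradiction R≤ (<⇒≱ (s≤s (≤-trans (≤-reflexive (sum-zero (λ i → cong ind (none i)))) z≤n)))
... | inj₂ (u , pu , min) = σ , p∘σ , λ {i} {j} → increasing i j
  where
  p′ : Fin n → Bool
  p′ v = p v ∧ not (does (u ≟ v))
  p′⇒p : ∀ v → p′ v ≡ true → p v ≡ true × u ≢ v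
  p′⇒p v eq with p v | u ≟ v
  ... | true | no u≢v = refl , u≢v
  split : ∀ v → ind (p v) ≤ δ u v + ind (p′ v)
  split v with p v | does (u ≟ v)
  ... | false | _     = z≤n
  ... | true  | true  = ≤-refl
  ... | true  | false = ≤-refl
  R≤′ : R ≤ sum (ind ∘ p′)
  R≤′ = s≤s⁻¹ (begin
    suc R                                 ≤⟨ R≤ ⟩
    sum (ind ∘ p)                         ≤⟨ sum-mono-≤ split ⟩
    sum (λ v → δ u v + ind (p′ v))        ≡⟨ ∑-distrib-+ (δ u) (ind ∘ p′) ⟩
    sum (δ u) + sum (ind ∘ p′)            ≡⟨ cong (_+ sum (ind ∘ p′)) (sum-δ-1 u) ⟩
    1 + sum (ind ∘ p′)                    ∎)
    where open ≤-Reasoning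
  rest = sorted-enumeration R p′ f inj R≤′
  σ : Fin (suc R) → Fin n
  σ zero    = u
  σ (suc i) = proj₁ rest i
  p∘σ : ∀ i → p (σ i) ≡ true
  p∘σ zero    = pu
  p∘σ (suc i) = proj₁ (p′⇒p _ (proj₁ (proj₂ rest) i))
  increasing : ∀ i j → toℕ i < toℕ j → f (σ i) < f (σ j)
  increasing zero (suc j) _ = let (pv , u≢v) = p′⇒p _ (proj₁ (proj₂ rest) j) in ≤∧≢⇒< (min _ pv) (u≢v ∘ inj)
  increasing (suc i) (suc j) (s≤s i<j) = proj₂ (proj₂ rest) i<j

-- Strictly increasing naturals grow at least as fast as their indices. This turns indices `t` apart
-- into positions `t` apart, hence into different slots.
increasing-gap : ∀ {R} (x : Fin R → ℕ) → (∀ {i j} → toℕ i < toℕ j → x i < x j) →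
  ∀ d i j → toℕ i + d ≤ toℕ j → x i + d ≤ x j
increasing-gap x incr zero i j le with m≤n⇒m<n∨m≡n (≤-trans (≤-reflexive (sym (+-identityʳ (toℕ i)))) le)
... | inj₁ lt = ≤-trans (≤-reflexive (+-identityʳ (x i))) (<⇒≤ (incr lt))
... | inj₂ eq = ≤-reflexive (trans (+-identityʳ (x i)) (cong x (toℕ-injective eq)))
increasing-gap {R} x incr (suc d) i j le = begin
  x i + suc d   ≡⟨ +-suc (x i) d ⟩
  suc (x i) + d ≤⟨ +-monoˡ-≤ d (incr (≤-reflexive (sym i′≡))) ⟩
  x i′ + d      ≤⟨ increasing-gap x incr d i′ j (≤-trans (≤-reflexive (cong (_+ d) i′≡)) le′) ⟩
  x j           ∎
  where
  open ≤-Reasoning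
  le′ : suc (toℕ i) + d ≤ toℕ j
  le′ = ≤-trans (≤-reflexive (sym (+-suc (toℕ i) d))) le
  i<R : suc (toℕ i) < R
  i<R = ≤-<-trans (≤-trans (m≤m+n _ d) le′) (toℕ<n j)
  i′ = fromℕ< i<R
  i′≡ : toℕ i′ ≡ suc (toℕ i)
  i′≡ = toℕ-fromℕ< i<R

-- Boolean comparisons and their indicators.

≡ᵇ-true : ∀ {a b} → (a ≡ᵇ b) ≡ true → a ≡ b
≡ᵇ-true {a} {b} eq = ≡ᵇ⇒≡ a b (subst T (sym eq) tt)

≡ᵇ-refl : ∀ {a b} → a ≡ b → (a ≡ᵇ b) ≡ true
≡ᵇ-refl {a} {b} eq = dec-true (a ℕ≟ b) eq

<ᵇ-true : ∀ {a b} → a < b → (a <ᵇ b) ≡ true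
<ᵇ-true {a} {b} lt = dec-true (a <? b) lt

∧-true : ∀ {a b} → a ∧ b ≡ true → a ≡ true × b ≡ true
∧-true {true} {true} refl = refl , refl

ind-∨ : ∀ a b → ind (a ∨ b) ≤ ind a + ind b
ind-∨ true  b = s≤s z≤n
ind-∨ false b = ≤-refl

ind-∧ : ∀ a b → ind (a ∧ b) ≡ ind a * ind b
ind-∧ true  b = sym (+-identityʳ (ind b))
ind-∧ false b = refl

sum-<ᵇ : ∀ n Δ → Δ ≤ n → sum {n} (λ u → ind (toℕ u <ᵇ Δ)) ≡ Δ
sum-<ᵇ zero    zero    _         = refl
sum-<ᵇ (suc n) zero    _         = sum-<ᵇ n zero z≤n
sum-<ᵇ (suc n) (suc Δ) (s≤s Δ≤n) = cong suc (sum-<ᵇ n Δ Δ≤n)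

sum-≡ᵇ-≤1 : ∀ {n} (f : ℕ → ℕ) x → (∀ a b → f a ≡ x → f b ≡ x → a ≡ b) → sum {n} (λ i → ind (f (toℕ i) ≡ᵇ x)) ≤ 1
sum-≡ᵇ-≤1 {n} f x unique = sum-≤1 {n} _ λ i j p q → toℕ-injective (unique (toℕ i) (toℕ j) (≡ᵇ-true p) (≡ᵇ-true q))

-- The graded graph, its degrees and its kept vertices.

-- Level h + 1 is joined to level h along the edges of e between the vertices kept; a star at
-- the vertex 0 of level 0 realises the maximum degree exactly.
module GradedGraph (H n Δ m : ℕ) (e : Fin m → Fin n × Fin n) where

  source target : Fin m → Fin n
  source = proj₁ ∘ e
  target = proj₂ ∘ e

  multidegree : Fin n → ℕ
  multidegree v = (sum λ i → δ (source i) v) + (sum λ i → δ (target i) v)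

  -- The vertex 0 is excluded so that the centre of the star has no further neighbours, and the
  -- inequality is strict to leave room for one star edge.
  kept : Fin n → Bool
  kept v = not (toℕ v ≡ᵇ 0) ∧ (multidegree v <ᵇ Δ)

  listed : Fin n → Fin n → Bool
  listed u v = does (any? λ i → source i ≟ u ×-dec target i ≟ v)

  star : Fin H → Fin n → Fin n → Bool
  star h u v = (toℕ h ≡ᵇ 0) ∧ ((toℕ u ≡ᵇ 0) ∧ (toℕ v <ᵇ Δ))

  link : Fin H × Fin n → Fin H × Fin n → Bool
  link (h , u) (h′ , v) = (toℕ h′ ≡ᵇ suc (toℕ h)) ∧ (star h u v ∨ (kept u ∧ (kept v ∧ listed u v)))

  coordinates : Fin (H * n) → Fin H × Fin n
  coordinates = remQuot {H} n

  G : Digraph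
  G = mkDigraph (H * n) λ x y → link (coordinates x) (coordinates y)

  level : Fin (H * n) → Fin H
  level = proj₁ ∘ coordinates

  graded : IsGradedPartition G H level
  graded x y xy = ≡ᵇ-true (proj₁ (∧-true xy))

  partSize-level : ∀ i → partSize G level i ≤ n
  partSize-level i = begin
    partSize G level i                    ≡⟨ count≡sum (λ x → does (level x ≟ i)) ⟩
    sum (λ x → δ (level x) i)             ≡⟨ sum-remQuot H n (λ h _ → δ h i) ⟩
    sum (λ h → sum {n} λ _ → δ h i)       ≡⟨ sum-cong-≗ {H} (λ h → trans (sum-const n (δ h i)) (*-comm n (δ h i))) ⟩
    sum (λ h → δ h i * n)                 ≡⟨ *-distribʳ-sum n (λ h → δ h i) ⟨
    sum (λ h → δ h i) * n                 ≤⟨ *-monoˡ-≤ n (sum-δ-injective (λ h → h) (λ eq → eq) i) ⟩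
    1 * n                                 ≡⟨ *-identityˡ n ⟩
    n                                     ∎
    where open ≤-Reasoning

  edge-kept : ∀ {h h′} i → toℕ h′ ≡ suc (toℕ h) → kept (source i) ≡ true → kept (target i) ≡ true →
    edge G (combine h (source i)) (combine h′ (target i)) ≡ true
  edge-kept {h} {h′} i h′≡ ks kt = trans (cong₂ link (remQuot-combine h (source i)) (remQuot-combine h′ (target i))) link≡
    where
    link≡ : link (h , source i) (h′ , target i) ≡ true
    link≡ rewrite ≡ᵇ-refl h′≡ | ks | kt
                | dec-true (any? λ j → source j ≟ source i ×-dec target j ≟ target i) (i , refl , refl) = ∨-zeroʳ (star h (source i) (target i))

  multiplicity : Fin n → Fin n → ℕ
  multiplicity u v = sum λ i → δ (source i) u * δ (target i) v

  listed-≤ : ∀ u v → ind (listed u v) ≤ multiplicity u v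
  listed-≤ u v with any? (λ i → source i ≟ u ×-dec target i ≟ v)
  ... | no _  = z≤n
  ... | yes (i , si , ti) = ≤-trans (≤-reflexive (sym (cong₂ (λ a b → ind a * ind b) (dec-true (source i ≟ u) si) (dec-true (target i ≟ v) ti))))
                                    (term≤sum (λ i → δ (source i) u * δ (target i) v) i)

  out-multiplicity : ∀ u → sum (multiplicity u) ≡ sum λ i → δ (source i) u
  out-multiplicity u = trans (∑-comm {n} {m} _) (sum-cong-≗ λ i →
    trans (sym (*-distribˡ-sum (δ (source i) u) (δ (target i)))) (trans (cong (δ (source i) u *_) (sum-δ-1 (target i))) (*-identityʳ _)))

  in-multiplicity : ∀ v → sum (λ u → multiplicity u v) ≡ sum λ i → δ (target i) v
  in-multiplicity v = trans (∑-comm {n} {m} _) (sum-cong-≗ λ i →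
    trans (sym (*-distribʳ-sum (δ (target i) v) (δ (source i)))) (trans (cong (_* δ (target i) v) (sum-δ-1 (source i))) (*-identityˡ _)))

  degree≡ : ∀ x → degree G x ≡ sum {H} λ h → sum {n} λ u → ind (link (h , u) (coordinates x) ∨ link (coordinates x) (h , u))
  degree≡ x = trans (count≡sum (λ y → edge G y x ∨ edge G x y))
                    (sum-remQuot H n λ h u → ind (link (h , u) (coordinates x) ∨ link (coordinates x) (h , u)))

  centre? : Fin H × Fin n → Bool
  centre? (h , u) = (toℕ h ≡ᵇ 0) ∧ (toℕ u ≡ᵇ 0)

  -- No edge enters level 0 and the vertex 0 is not kept, so the neighbours of the centre are the
  -- first `Δ` vertices of level 1.
  centre-degree : Δ ≤ n → 2 ≤ H → ∀ h v → toℕ h ≡ 0 → toℕ v ≡ 0 →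
    (sum {H} λ h′ → sum {n} λ u → ind (link (h′ , u) (h , v) ∨ link (h , v) (h′ , u))) ≡ Δ
  centre-degree Δ≤n 2≤H h v h≡0 v≡0 = begin
    sum {H} (λ h′ → sum {n} λ u → ind (link (h′ , u) (h , v) ∨ link (h , v) (h′ , u)))
      ≡⟨ sum-cong-≗ {H} (λ h′ → sum-cong-≗ {n} λ u → cell h′ u) ⟩
    sum {H} (λ h′ → sum {n} λ u → ind (toℕ h′ ≡ᵇ 1) * ind (toℕ u <ᵇ Δ))
      ≡⟨ sum-*-sum {H} {n} (λ h′ → ind (toℕ h′ ≡ᵇ 1)) (λ u → ind (toℕ u <ᵇ Δ)) ⟩
    sum (λ (h′ : Fin H) → ind (toℕ h′ ≡ᵇ 1)) * sum (λ (u : Fin n) → ind (toℕ u <ᵇ Δ))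
      ≡⟨ cong₂ _*_ (second H 2≤H) (sum-<ᵇ n Δ Δ≤n) ⟩
    1 * Δ
      ≡⟨ *-identityˡ Δ ⟩
    Δ ∎
    where
    open ≡-Reasoning
    second : ∀ H → 2 ≤ H → sum {H} (λ h′ → ind (toℕ h′ ≡ᵇ 1)) ≡ 1
    second (suc (suc H)) _ = cong suc (sum-zero {H} λ _ → refl)
    second (suc zero) (s≤s ())
    cell : ∀ h′ u → ind (link (h′ , u) (h , v) ∨ link (h , v) (h′ , u)) ≡ ind (toℕ h′ ≡ᵇ 1) * ind (toℕ u <ᵇ Δ)
    cell h′ u rewrite h≡0 | v≡0 | ∨-identityʳ (toℕ u <ᵇ Δ) = ind-∧ (toℕ h′ ≡ᵇ 1) (toℕ u <ᵇ Δ)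

  -- A vertex other than the centre meets at most one star edge. Its other edges number at most its
  -- multidegree, as repeated pairs of `e` give one edge, and there are none unless it is kept,
  -- which is recorded by the factor `κ`.
  degree-bound : 1 ≤ Δ → ∀ h v → centre? (h , v) ≡ false →
    (sum {H} λ h′ → sum {n} λ u → ind (link (h′ , u) (h , v) ∨ link (h , v) (h′ , u))) ≤ Δ
  degree-bound 1≤Δ h v off = begin
    sum {H} (λ h′ → sum {n} λ u → ind (link (h′ , u) (h , v) ∨ link (h , v) (h′ , u)))
      ≤⟨ sum-mono-≤ {H} (λ h′ → sum-mono-≤ {n} λ u → cell h′ u) ⟩
    sum {H} (λ h′ → sum {n} λ u → ind (toℕ h′ ≡ᵇ 0) * ind (toℕ u ≡ᵇ 0) + (below h′ * (κ * multiplicity u v) + above h′ * (κ * multiplicity v u)))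
      ≡⟨ trans (sum-cong-≗ {H} λ h′ → ∑-distrib-+ {n} (λ u → ind (toℕ h′ ≡ᵇ 0) * ind (toℕ u ≡ᵇ 0)) _) (∑-distrib-+ {H} (λ h′ → sum {n} λ u → ind (toℕ h′ ≡ᵇ 0) * ind (toℕ {n} u ≡ᵇ 0)) _) ⟩
    sum {H} (λ h′ → sum {n} λ u → ind (toℕ h′ ≡ᵇ 0) * ind (toℕ u ≡ᵇ 0)) + sum {H} (λ h′ → sum {n} λ u → below h′ * (κ * multiplicity u v) + above h′ * (κ * multiplicity v u))
      ≡⟨ cong₂ _+_ (sum-*-sum {H} {n} (λ h′ → ind (toℕ h′ ≡ᵇ 0)) (λ u → ind (toℕ u ≡ᵇ 0)))
           (trans (sum-cong-≗ {H} λ h′ → ∑-distrib-+ {n} (λ u → below h′ * (κ * multiplicity u v)) (λ u → above h′ * (κ * multiplicity v u)))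
                  (∑-distrib-+ {H} (λ h′ → sum {n} λ u → below h′ * (κ * multiplicity u v)) _)) ⟩
    sum (λ (h′ : Fin H) → ind (toℕ h′ ≡ᵇ 0)) * sum (λ (u : Fin n) → ind (toℕ u ≡ᵇ 0))
      + (sum {H} (λ h′ → sum {n} λ u → below h′ * (κ * multiplicity u v)) + sum {H} (λ h′ → sum {n} λ u → above h′ * (κ * multiplicity v u)))
      ≡⟨ cong (sum (λ (h′ : Fin H) → ind (toℕ h′ ≡ᵇ 0)) * sum (λ (u : Fin n) → ind (toℕ u ≡ᵇ 0)) +_)
           (cong₂ _+_ (sum-*-sum {H} {n} below (λ u → κ * multiplicity u v)) (sum-*-sum {H} {n} above (λ u → κ * multiplicity v u))) ⟩
    sum (λ (h′ : Fin H) → ind (toℕ h′ ≡ᵇ 0)) * sum (λ (u : Fin n) → ind (toℕ u ≡ᵇ 0))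
      + (sum below * sum {n} (λ u → κ * multiplicity u v) + sum above * sum {n} (λ u → κ * multiplicity v u))
      ≤⟨ +-mono-≤ (*-mono-≤ (sum-≡ᵇ-≤1 {H} id 0 λ a b p q → trans p (sym q)) (sum-≡ᵇ-≤1 {n} id 0 λ a b p q → trans p (sym q)))
           (+-mono-≤ (*-monoˡ-≤ (sum {n} λ u → κ * multiplicity u v) (sum-≤1 {H} (λ h′ → toℕ h ≡ᵇ suc (toℕ h′)) λ i j p q →
                        toℕ-injective (ℕ-suc-injective (trans (sym (≡ᵇ-true {toℕ h} p)) (≡ᵇ-true {toℕ h} q)))))
                     (*-monoˡ-≤ (sum {n} λ u → κ * multiplicity v u) (sum-≡ᵇ-≤1 {H} id (suc (toℕ h)) λ a b p q → trans p (sym q)))) ⟩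
    1 + (1 * sum {n} (λ u → κ * multiplicity u v) + 1 * sum {n} (λ u → κ * multiplicity v u))
      ≡⟨ cong suc (cong₂ _+_ (trans (*-identityˡ _) (trans (sym (*-distribˡ-sum {n} κ λ u → multiplicity u v)) (cong (κ *_) (in-multiplicity v))))
                             (trans (*-identityˡ _) (trans (sym (*-distribˡ-sum κ (multiplicity v))) (cong (κ *_) (out-multiplicity v))))) ⟩
    1 + (κ * sum (λ i → δ (target i) v) + κ * sum (λ i → δ (source i) v))
      ≡⟨ cong suc (trans (sym (*-distribˡ-+ κ _ _)) (cong (κ *_) (+-comm (sum λ i → δ (target i) v) _))) ⟩
    1 + κ * multidegree v
      ≤⟨ κ-bound ⟩
    Δ ∎
    where
    open ≤-Reasoning
    κ = ind (kept v)
    below above : Fin H → ℕ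
    below h′ = ind (toℕ h ≡ᵇ suc (toℕ h′))
    above h′ = ind (toℕ h′ ≡ᵇ suc (toℕ h))
    κ-bound : 1 + κ * multidegree v ≤ Δ
    κ-bound with toℕ v ≡ᵇ 0 | multidegree v <ᵇ Δ in lt
    ... | true  | _     = 1≤Δ
    ... | false | false = 1≤Δ
    ... | false | true  = ≤-trans (≤-reflexive (cong suc (*-identityˡ _))) (<ᵇ⇒< _ Δ (subst T (sym lt) tt))
    into : ∀ h′ u → ind (link (h′ , u) (h , v)) ≤ ind (toℕ h′ ≡ᵇ 0) * ind (toℕ u ≡ᵇ 0) + below h′ * (κ * multiplicity u v)
    into h′ u = lemma (toℕ h ≡ᵇ suc (toℕ h′)) (toℕ h′ ≡ᵇ 0) (toℕ u ≡ᵇ 0) (toℕ v <ᵇ Δ) (kept u) (kept v) (listed u v) (listed-≤ u v)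
      where
      lemma : ∀ b z w t ku kv l {L} → ind l ≤ L →
        ind (b ∧ ((z ∧ (w ∧ t)) ∨ (ku ∧ (kv ∧ l)))) ≤ ind z * ind w + ind b * (ind kv * L)
      lemma false _     _     _ _     _     _ _  = z≤n
      lemma true  true  true  _ _     _     _ _  = ≤-trans (ind-≤1 _) (s≤s z≤n)
      lemma true  false _     _ false _     _ _  = z≤n
      lemma true  false _     _ true  false _ _  = z≤n
      lemma true  false _     _ true  true  l le = ≤-trans le (≤-reflexive (sym (trans (+-identityʳ _) (+-identityʳ _))))
      lemma true  true  false _ false _     _ _  = z≤n
      lemma true  true  false _ true  false _ _  = z≤n
      lemma true  true  false _ true  true  l le = ≤-trans le (≤-reflexive (sym (trans (+-identityʳ _) (+-identityʳ _))))
    out : ∀ h′ u → ind (link (h , v) (h′ , u)) ≤ above h′ * (κ * multiplicity v u)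
    out h′ u = lemma (toℕ h′ ≡ᵇ suc (toℕ h)) (toℕ h ≡ᵇ 0) (toℕ v ≡ᵇ 0) (toℕ u <ᵇ Δ) (kept v) (kept u) (listed v u) off (listed-≤ v u)
      where
      lemma : ∀ b z w t kv ku l {L} → z ∧ w ≡ false → ind l ≤ L →
        ind (b ∧ ((z ∧ (w ∧ t)) ∨ (kv ∧ (ku ∧ l)))) ≤ ind b * (ind kv * L)
      lemma false _     _     _ _     _     _ _ _  = z≤n
      lemma true  false _     _ false _     _ _ _  = z≤n
      lemma true  false _     _ true  false _ _ _  = z≤n
      lemma true  false _     _ true  true  l _ le = ≤-trans le (≤-reflexive (sym (trans (+-identityʳ _) (+-identityʳ _))))
      lemma true  true  false _ false _     _ _ _  = z≤n
      lemma true  true  false _ true  false _ _ _  = z≤n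
      lemma true  true  false _ true  true  l _ le = ≤-trans le (≤-reflexive (sym (trans (+-identityʳ _) (+-identityʳ _))))
    cell : ∀ h′ u → ind (link (h′ , u) (h , v) ∨ link (h , v) (h′ , u)) ≤
      ind (toℕ h′ ≡ᵇ 0) * ind (toℕ u ≡ᵇ 0) + (below h′ * (κ * multiplicity u v) + above h′ * (κ * multiplicity v u))
    cell h′ u = ≤-trans (ind-∨ (link (h′ , u) (h , v)) _) (≤-trans (+-mono-≤ (into h′ u) (out h′ u)) (≤-reflexive (+-assoc (ind (toℕ h′ ≡ᵇ 0) * ind (toℕ u ≡ᵇ 0)) _ _)))

  maxDegree : 1 ≤ Δ → Δ ≤ n → 2 ≤ H → MaxDegree G Δ
  maxDegree 1≤Δ Δ≤n 2≤H = bound , combine h₀ v₀ , trans (degree≡ (combine h₀ v₀))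
    (trans (cong total (remQuot-combine h₀ v₀)) (centre-degree Δ≤n 2≤H h₀ v₀ (toℕ-fromℕ< _) (toℕ-fromℕ< _)))
    where
    total : Fin H × Fin n → ℕ
    total c = sum {H} λ h → sum {n} λ u → ind (link (h , u) c ∨ link c (h , u))
    h₀ = fromℕ< (≤-trans (s≤s z≤n) 2≤H)
    v₀ = fromℕ< (≤-trans 1≤Δ Δ≤n)
    bound : ∀ x → degree G x ≤ Δ
    bound x with centre? (coordinates x) in eq
    ... | false = ≤-trans (≤-reflexive (degree≡ x)) (degree-bound 1≤Δ _ _ eq)
    ... | true  = ≤-reflexive (trans (degree≡ x) (centre-degree Δ≤n 2≤H _ _ (≡ᵇ-true (proj₁ (∧-true eq))) (≡ᵇ-true (proj₂ (∧-true eq)))))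

  sum-multidegree : sum multidegree ≡ m + m
  sum-multidegree = trans (∑-distrib-+ {n} _ _) (cong₂ _+_ (total source) (total target))
    where
    total : (f : Fin m → Fin n) → sum (λ v → sum λ i → δ (f i) v) ≡ m
    total f = trans (∑-comm {n} {m} _) (trans (sum-cong-≗ λ i → sum-δ-1 (f i)) (trans (sum-const m 1) (*-identityʳ m)))

  -- A lost vertex is the vertex 0 or has multidegree at least `Δ`. The multidegrees sum to `2 * m`,
  -- at most `Δ * n / 8`, so at most `1 + n / 8` vertices are lost.
  most-kept : 8 ≤ n → .{{_ : NonZero Δ}} → 16 * m ≤ Δ * n → n ≤ 2 * sum (ind ∘ kept)
  most-kept 8≤n few = +-cancelʳ-≤ n _ _ (begin
    n + n ≡⟨ cong₂ _+_ (sum-ind-+-not kept) (sum-ind-+-not kept) ⟨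
    (K + L) + (K + L) ≡⟨ lemma₁ K L ⟩
    2 * K + 2 * L ≤⟨ +-monoʳ-≤ (2 * K) 2L≤n ⟩
    2 * K + n ∎)
    where
    open ≤-Reasoning
    K = sum (ind ∘ kept)
    L = sum (ind ∘ not ∘ kept)
    lemma₁ : ∀ a b → (a + b) + (a + b) ≡ 2 * a + 2 * b
    lemma₁ = solve-∀
    lemma₂ : ∀ a b → 4 * a * (2 * b) ≡ 8 * (a * b)
    lemma₂ = solve-∀
    lemma₃ : ∀ a b → 8 * (a + (b + b)) ≡ 8 * a + 16 * b
    lemma₃ = solve-∀
    lemma₄ : ∀ a b → 4 * a * b ≡ 3 * (a * b) + a * b
    lemma₄ = solve-∀
    lost : ∀ v → Δ * ind (not (kept v)) ≤ Δ * ind (toℕ v ≡ᵇ 0) + multidegree v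
    lost v with toℕ v ≡ᵇ 0 | multidegree v <ᵇ Δ in ge
    ... | true  | _     = m≤m+n _ _
    ... | false | true  = ≤-trans (≤-reflexive (*-zeroʳ Δ)) z≤n
    ... | false | false = ≤-trans (≤-reflexive (*-identityʳ Δ)) (≤-trans (≮⇒≥ (λ lt → contradiction (trans (sym (<ᵇ-true lt)) ge) λ ())) (m≤n+m _ (Δ * 0)))
    2L≤n : 2 * L ≤ n
    2L≤n = *-cancelˡ-≤ (4 * Δ) {{m*n≢0 4 Δ}} (begin
      4 * Δ * (2 * L) ≡⟨ lemma₂ Δ L ⟩
      8 * (Δ * L) ≡⟨ cong (8 *_) (*-distribˡ-sum Δ (ind ∘ not ∘ kept)) ⟩
      8 * sum (λ v → Δ * ind (not (kept v))) ≤⟨ *-monoʳ-≤ 8 (sum-mono-≤ lost) ⟩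
      8 * sum (λ v → Δ * ind (toℕ v ≡ᵇ 0) + multidegree v) ≡⟨ cong (8 *_) (trans (∑-distrib-+ {n} (λ v → Δ * ind (toℕ v ≡ᵇ 0)) multidegree) (cong₂ _+_ (sym (*-distribˡ-sum {n} Δ (λ v → ind (toℕ v ≡ᵇ 0)))) sum-multidegree)) ⟩
      8 * (Δ * sum (λ (v : Fin n) → ind (toℕ v ≡ᵇ 0)) + (m + m)) ≤⟨ *-monoʳ-≤ 8 (+-monoˡ-≤ (m + m) (≤-trans (*-monoʳ-≤ Δ (sum-≡ᵇ-≤1 {n} id 0 λ a b p q → trans p (sym q))) (≤-reflexive (*-identityʳ Δ)))) ⟩
      8 * (Δ + (m + m)) ≡⟨ lemma₃ Δ m ⟩
      8 * Δ + 16 * m ≤⟨ +-mono-≤ (≤-trans (*-monoˡ-≤ Δ (≤-trans 8≤n (m≤m+n n _))) (≤-reflexive (trans (*-assoc 3 n Δ) (cong (3 *_) (*-comm n Δ))))) few ⟩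
      3 * (Δ * n) + Δ * n ≡⟨ lemma₄ Δ n ⟨
      4 * Δ * n ∎)

-- The tournament of blocks and slots.

module BlockTournament (k t N : ℕ) .{{_ : NonZero k}} .{{_ : NonZero t}} (χ : Fin k → Fin k → Bool) where

  slot block : ℕ → ℕ
  slot a  = a / t
  block a = slot a / k

  node : ℕ → Fin k
  node a = slot a mod k

  forward : ℕ → ℕ → Bool
  forward a b = not (block a ≡ᵇ block b) ∨ χ (node a) (node b)

  arc : ℕ → ℕ → Bool
  arc a b = if a <ᵇ b then forward a b else not (forward b a)

  tournament : Fin N → Fin N → Bool
  tournament i j = arc (toℕ i) (toℕ j)

  arc-< : ∀ {a b} → a < b → arc a b ≡ forward a b
  arc-< lt rewrite <ᵇ-true lt = refl

  arc-≥ : ∀ {a b} → b ≤ a → arc a b ≡ not (forward b a)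
  arc-≥ {a} {b} ge with a <ᵇ b in eq
  ... | true  = contradiction (<ᵇ⇒< a b (subst T (sym eq) tt)) (≤⇒≯ ge)
  ... | false = refl

  isTournament : IsTournament N tournament
  isTournament i j i≢j eq with <-cmp (toℕ i) (toℕ j)
  ... | tri< lt _ _ = not-¬ refl (trans (sym (arc-< lt)) (trans eq (arc-≥ (<⇒≤ lt))))
  ... | tri≈ _ ij _ = i≢j (toℕ-injective ij)
  ... | tri> _ _ gt = not-¬ refl (trans (sym (arc-< gt)) (trans (sym eq) (arc-≥ (<⇒≤ gt))))

  block-mono : ∀ {a b} → a ≤ b → block a ≤ block b
  block-mono le = /-monoˡ-≤ k (/-monoˡ-≤ t le)

  -- Arcs between different blocks follow the order, so an arc against the order stays inside its
  -- block.
  arc-block : ∀ {a b} → arc a b ≡ true → block a ≤ block b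
  arc-block {a} {b} ab with <-≤-connex a b
  ... | inj₁ lt = block-mono (<⇒≤ lt)
  ... | inj₂ ge with block b ≡ᵇ block a in eq | trans (sym (arc-≥ ge)) ab
  ...   | true | _ = ≤-reflexive (sym (≡ᵇ-true eq))

  arc-node-< : ∀ {a b} → a < b → block a ≡ block b → arc a b ≡ true → χ (node a) (node b) ≡ true
  arc-node-< lt same ab with trans (sym (arc-< lt)) ab
  ... | fwd rewrite ≡ᵇ-refl same = fwd

  arc-node-> : ∀ {a b} → b < a → block a ≡ block b → arc a b ≡ true → χ (node b) (node a) ≡ false
  arc-node-> {a} {b} gt same ab with trans (sym (arc-≥ (<⇒≤ gt))) ab
  ... | bwd rewrite ≡ᵇ-refl (sym same) = trans (sym (not-involutive _)) (cong not bwd)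

  -- Positions at least `t` apart lie in different slots, whereas block and node together determine
  -- the slot.
  node-≢ : ∀ {a b} → a + t ≤ b → block a ≡ block b → node a ≢ node b
  node-≢ {a} {b} gap same eq = <⇒≢ slot-< slot-≡
    where
    open ≤-Reasoning
    slot-≡ : slot a ≡ slot b
    slot-≡ = begin-equality
      slot a                      ≡⟨ m≡m%n+[m/n]*n (slot a) k ⟩
      slot a % k + block a * k    ≡⟨ cong₂ (λ x y → x + y * k) (trans (sym (toℕ-fromℕ< (m%n<n (slot a) k))) (trans (cong toℕ eq) (toℕ-fromℕ< (m%n<n (slot b) k)))) same ⟩
      slot b % k + block b * k    ≡⟨ m≡m%n+[m/n]*n (slot b) k ⟨
      slot b                      ∎
    slot-< : slot a < slot b
    slot-< = begin-strict
      slot a                  ≤⟨ /-monoˡ-≤ t (m+n≤o⇒m≤o∸n a gap) ⟩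
      (b ∸ t) / t             <⟨ n<1+n _ ⟩
      1 + (b ∸ t) / t         ≡⟨ m/n≡1+[m∸n]/n {b} {t} (≤-trans (m≤n+m t a) gap) ⟨
      slot b                  ∎

  block-bound : ∀ a → block a * (k * t) ≤ a
  block-bound a = begin
    block a * (k * t)  ≡⟨ *-assoc (block a) k t ⟨
    block a * k * t    ≤⟨ *-monoˡ-≤ t (m/n*n≤m (slot a) k) ⟩
    slot a * t         ≤⟨ m/n*n≤m a t ⟩
    a                  ∎
    where open ≤-Reasoning

-- Refuting a copy of the graph in the tournament.

module NoCopy {H n Δ m k s t N : ℕ} .{{_ : NonZero k}} .{{_ : NonZero s}} .{{_ : NonZero t}}
  (e : Fin m → Fin n × Fin n) (χ : Fin k → Fin k → Bool)
  (balanced : ∀ (α β : Fin s → Fin k) → Injective _≡_ _≡_ α → Injective _≡_ _≡_ β →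
    ∀ c → s * s ≤ 4 * sum λ i → sum λ j → agreement c (χ (α i) (β j)))
  (hits : ∀ (a b : Fin n → Fin (suc k)) c → (s * t) * (s * t) ≤ 4 * sum (λ u → sum λ v → ind (hit χ c (a u) (b v))) →
    ∃ λ i → hit χ c (a (proj₁ (e i))) (b (proj₂ (e i))) ≡ true)
  (many-kept : 4 * (s * t) ≤ sum (ind ∘ GradedGraph.kept H n Δ m e))
  (2≤H : 2 ≤ H) (N≤ : 4 * N ≤ H * (k * t))
  (copy : ContainsCopy N (BlockTournament.tournament k t N χ) (GradedGraph.G H n Δ m e)) where

  open GradedGraph H n Δ m e
  open BlockTournament k t N χ

  r : ℕ
  r = s * t

  f : Fin (H * n) → Fin N
  f = proj₁ copy

  position : Fin H → Fin n → ℕ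
  position h u = toℕ (f (combine h u))

  position-injective : ∀ h → Injective _≡_ _≡_ (position h)
  position-injective h {u} {v} eq = combine-injectiveʳ h u h v (proj₁ (proj₂ copy) (toℕ-injective eq))

  sorted : ∀ h → ∃ λ (σ : Fin (4 * r) → Fin n) → (∀ i → kept (σ i) ≡ true) ×
    (∀ {i j} → toℕ i < toℕ j → position h (σ i) < position h (σ j))
  sorted h = sorted-enumeration (4 * r) kept (position h) (position-injective h) many-kept

  member : Fin H → Fin 4 → Fin r → Fin n
  member h q i = proj₁ (sorted h) (combine q i)

  place : Fin H → Fin 4 → Fin r → ℕ
  place h q i = position h (member h q i)

  member-injective : ∀ h q → Injective _≡_ _≡_ (member h q)
  member-injective h q {i} {j} eq with <-cmp (toℕ (combine q i)) (toℕ (combine q j))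
  ... | tri< lt _ _ = contradiction (cong (position h) eq) (<⇒≢ (proj₂ (proj₂ (sorted h)) lt))
  ... | tri≈ _ ij _ = combine-injectiveʳ q i q j (toℕ-injective ij)
  ... | tri> _ _ gt = contradiction (cong (position h) (sym eq)) (<⇒≢ (proj₂ (proj₂ (sorted h)) gt))

  0<r : 0 < r
  0<r = >-nonZero⁻¹ r {{m*n≢0 s t}}

  first : Fin r
  first = fromℕ< 0<r

  -- The least position in a quarter, strictly above all positions of the earlier quarters. Quarters
  -- can thus be described to `hits` by intervals of positions.
  threshold : Fin H → Fin 4 → ℕ
  threshold h q = place h q first

  place-< : ∀ h q q′ i j → toℕ q < toℕ q′ → place h q i < place h q′ j
  place-< h q q′ i j lt = proj₂ (proj₂ (sorted h)) (combine-monoˡ-< i j lt)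

  threshold-≤ : ∀ h q i → threshold h q ≤ place h q i
  threshold-≤ h q i with m≤n⇒m<n∨m≡n {toℕ first} {toℕ i} (≤-trans (≤-reflexive (toℕ-fromℕ< 0<r)) z≤n)
  ... | inj₁ lt = <⇒≤ (proj₂ (proj₂ (sorted h)) (begin-strict
      toℕ (combine q first)   ≡⟨ toℕ-combine q first ⟩
      r * toℕ q + toℕ first   <⟨ +-monoʳ-< (r * toℕ q) lt ⟩
      r * toℕ q + toℕ i       ≡⟨ toℕ-combine q i ⟨
      toℕ (combine q i)       ∎))
    where open ≤-Reasoning
  ... | inj₂ eq = ≤-reflexive (cong (place h q) (toℕ-injective eq))

  threshold-mono : ∀ h q q′ → toℕ q < toℕ q′ → threshold h q ≤ threshold h q′
  threshold-mono h q q′ lt = <⇒≤ (place-< h q q′ first first lt)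

  inside : ℕ → ℕ → Fin H → Fin n → Bool
  inside lo hi h u = kept u ∧ ((lo ≤ᵇ position h u) ∧ (position h u <ᵇ hi))

  inside-true : ∀ {lo hi} h u → inside lo hi h u ≡ true → kept u ≡ true × lo ≤ position h u × position h u < hi
  inside-true {lo} {hi} h u eq = let (ku , bounds) = ∧-true eq ; (l , r) = ∧-true bounds in
    ku , ≤ᵇ⇒≤ lo _ (subst T (sym l) tt) , <ᵇ⇒< _ hi (subst T (sym r) tt)

  -- The labelling `ν` is a parameter: it is `node` for the balance of the matrix, and constant when
  -- only the existence of an edge matters.
  mark : ℕ → ℕ → (ℕ → Fin k) → Fin H → Fin n → Fin (suc k)
  mark lo hi ν h u = if inside lo hi h u then suc (ν (position h u)) else zero

  mark-member : ∀ {lo hi} ν h q → (∀ i → lo ≤ place h q i) → (∀ i → place h q i < hi) →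
    ∀ i → mark lo hi ν h (member h q i) ≡ suc (ν (place h q i))
  mark-member {lo} {hi} ν h q ≥lo <hi i
    rewrite proj₁ (proj₂ (sorted h)) (combine q i) | dec-true (lo ≤? place h q i) (≥lo i) | <ᵇ-true (<hi i) = refl

  -- The label `zero` takes part in no hit, so both ends of a hit lie in their intervals.
  hit-marked : ∀ {lo hi lo′ hi′} ν h h′ u v c → hit χ c (mark lo hi ν h u) (mark lo′ hi′ ν h′ v) ≡ true →
    inside lo hi h u ≡ true × inside lo′ hi′ h′ v ≡ true ×
    hit χ c (suc (ν (position h u))) (suc (ν (position h′ v))) ≡ true
  hit-marked {lo} {hi} {lo′} {hi′} ν h h′ u v c eq with inside lo hi h u | inside lo′ hi′ h′ v
  hit-marked ν h h′ u v c     eq | true  | true  = refl , refl , eq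
  hit-marked ν h h′ u v true  () | true  | false
  hit-marked ν h h′ u v false () | true  | false

  record Arc (lo hi lo′ hi′ : ℕ) (ν : ℕ → Fin k) (c : Bool) : Set where
    field
      a b        : ℕ
      lo≤a       : lo ≤ a
      a<hi       : a < hi
      lo′≤b      : lo′ ≤ b
      b<hi′      : b < hi′
      is-arc     : arc a b ≡ true
      is-hit     : hit χ c (suc (ν a)) (suc (ν b)) ≡ true

  -- A dense test is met by a pair of `e`. Its ends are kept, as they lie inside the intervals, so
  -- the pair is an edge between the two levels and the copy sends it to an arc.
  find-arc : ∀ {lo hi lo′ hi′} ν c h h′ q q′ → toℕ h′ ≡ suc (toℕ h) →
    (∀ i → lo ≤ place h q i) → (∀ i → place h q i < hi) →
    (∀ i → lo′ ≤ place h′ q′ i) → (∀ i → place h′ q′ i < hi′) →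
    r * r ≤ 4 * sum (λ i → sum λ j → ind (hit χ c (suc (ν (place h q i))) (suc (ν (place h′ q′ j))))) →
    Arc lo hi lo′ hi′ ν c
  find-arc {lo} {hi} {lo′} {hi′} ν c h h′ q q′ next lo≤ <hi lo′≤ <hi′ dense =
    let (i , found)         = hits A B c (≤-trans dense (*-monoʳ-≤ 4 restrict))
        (in-u , in-v , hit) = hit-marked {lo} {hi} {lo′} {hi′} ν h h′ (source i) (target i) c found
        (ku , l , g)        = inside-true {lo} {hi} h (source i) in-u
        (kv , l′ , g′)      = inside-true {lo′} {hi′} h′ (target i) in-v
    in record { lo≤a = l ; a<hi = g ; lo′≤b = l′ ; b<hi′ = g′ ; is-hit = hit
              ; is-arc = proj₂ (proj₂ copy) _ _ (edge-kept {h} {h′} i next ku kv) }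
    where
    open ≤-Reasoning
    A = mark lo hi ν h
    B = mark lo′ hi′ ν h′
    -- The intervals may contain kept vertices outside the two quarters; these only add hits.
    restrict : sum (λ i → sum λ j → ind (hit χ c (suc (ν (place h q i))) (suc (ν (place h′ q′ j))))) ≤
      sum (λ u → sum λ v → ind (hit χ c (A u) (B v)))
    restrict = begin
      sum (λ i → sum λ j → ind (hit χ c (suc (ν (place h q i))) (suc (ν (place h′ q′ j)))))
        ≡⟨ sum-cong-≗ {r} (λ i → sum-cong-≗ {r} λ j → cong₂ (λ x y → ind (hit χ c x y)) (mark-member ν h q lo≤ <hi i) (mark-member ν h′ q′ lo′≤ <hi′ j)) ⟨
      sum (λ i → sum λ j → ind (hit χ c (A (member h q i)) (B (member h′ q′ j))))
        ≤⟨ sum-mono-≤ {r} (λ i → sum-∘-injective-≤ (member h′ q′) (member-injective h′ q′) λ v → ind (hit χ c (A (member h q i)) (B v))) ⟩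
      sum (λ i → sum λ v → ind (hit χ c (A (member h q i)) (B v)))
        ≤⟨ sum-∘-injective-≤ (member h q) (member-injective h q) (λ u → sum λ v → ind (hit χ c (A u) (B v))) ⟩
      sum (λ u → sum λ v → ind (hit χ c (A u) (B v))) ∎

  q₀ q₁ q₂ q₃ : Fin 4
  q₀ = zero
  q₁ = suc zero
  q₂ = suc (suc zero)
  q₃ = suc (suc (suc zero))

  -- The blocks of the upper and lower quartiles: the two middle quarters of the level lie between
  -- them.
  top bottom : Fin H → ℕ
  top h    = block (threshold h q₃)
  bottom h = block (threshold h q₁)

  -- Some edge leads from the last quarter of level `h` to the first quarter of the next level, and
  -- no arc leads to an earlier block.
  top≤bottom : ∀ h h′ → toℕ h′ ≡ suc (toℕ h) → top h ≤ bottom h′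
  top≤bottom h h′ next = begin
    top h             ≤⟨ block-mono lo≤a ⟩
    block a           ≤⟨ arc-block is-arc ⟩
    block b           ≤⟨ block-mono (<⇒≤ b<hi′) ⟩
    bottom h′         ∎
    where
    open ≤-Reasoning
    -- All vertices get the same label, and the bit is the diagonal value of `χ` there, so that
    -- every pair is a hit.
    p₀ : Fin k
    p₀ = node 0
    always : ∀ b → χ p₀ p₀ ≡ b → hit χ b (suc p₀) (suc p₀) ≡ true
    always true  eq = eq
    always false eq = cong not eq
    full : r * r ≤ 4 * sum {r} λ i → sum {r} λ j → ind (hit χ (χ p₀ p₀) (suc p₀) (suc p₀))
    full = begin
      r * r       ≤⟨ m≤n*m (r * r) 4 ⟩
      4 * (r * r) ≡⟨ cong (4 *_) (trans (sum-cong-≗ {r} λ i → trans (sum-const r _) (trans (cong (λ b → r * ind b) (always _ refl)) (*-identityʳ r))) (sum-const r r)) ⟨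
      4 * sum {r} (λ i → sum {r} λ j → ind (hit χ (χ p₀ p₀) (suc p₀) (suc p₀))) ∎
    open Arc (find-arc {threshold h q₃} {N} {0} {threshold h′ q₁} (λ _ → p₀) (χ p₀ p₀) h h′ q₃ q₀ next
      (threshold-≤ h q₃) (λ i → toℕ<n (f (combine h (member h q₃ i)))) (λ _ → z≤n) (λ i → place-< h′ q₀ q₁ i first (s≤s z≤n)) full)

  -- The indices `combine l ρ` with `ρ` fixed are at least `t` apart, hence so are the corresponding
  -- positions.
  node-place-≢ : ∀ h q {β} → (∀ i → block (place h q i) ≡ β) → ∀ ρ (l l′ : Fin s) →
    toℕ l < toℕ l′ → node (place h q (combine l ρ)) ≢ node (place h q (combine l′ ρ))
  node-place-≢ h q same ρ l l′ lt = node-≢ (increasing-gap (position h ∘ proj₁ (sorted h)) (proj₂ (proj₂ (sorted h))) t _ _ (begin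
    toℕ (combine q (combine l ρ)) + t       ≡⟨ cong (_+ t) (trans (toℕ-combine q _) (cong (r * toℕ q +_) (toℕ-combine l ρ))) ⟩
    r * toℕ q + (t * toℕ l + toℕ ρ) + t     ≡⟨ lemma (r * toℕ q) t (toℕ l) (toℕ ρ) ⟩
    r * toℕ q + (t * suc (toℕ l) + toℕ ρ)   ≤⟨ +-monoʳ-≤ (r * toℕ q) (+-monoˡ-≤ (toℕ ρ) (*-monoʳ-≤ t lt)) ⟩
    r * toℕ q + (t * toℕ l′ + toℕ ρ)        ≡⟨ trans (toℕ-combine q _) (cong (r * toℕ q +_) (toℕ-combine l′ ρ)) ⟨
    toℕ (combine q (combine l′ ρ))          ∎)) (trans (same _) (sym (same _)))
    where
    open ≤-Reasoning
    lemma : ∀ a b c d → a + (b * c + d) + b ≡ a + (b * suc c + d)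
    lemma = solve-∀

  nodes-injective : ∀ h q {β} → (∀ i → block (place h q i) ≡ β) →
    ∀ ρ → Injective _≡_ _≡_ λ (l : Fin s) → node (place h q (combine l ρ))
  nodes-injective h q same ρ {l} {l′} eq with <-cmp (toℕ l) (toℕ l′)
  ... | tri< lt _ _ = contradiction eq (node-place-≢ h q same ρ l l′ lt)
  ... | tri≈ _ ll _ = toℕ-injective ll
  ... | tri> _ _ gt = contradiction (sym eq) (node-place-≢ h q same ρ l′ l gt)

  dense : ∀ h h′ q q′ {β} → (∀ i → block (place h q i) ≡ β) → (∀ i → block (place h′ q′ i) ≡ β) → ∀ c →
    r * r ≤ 4 * sum (λ i → sum λ j → ind (hit χ c (suc (node (place h q i))) (suc (node (place h′ q′ j)))))
  dense h h′ q q′ same same′ false = balanced-on-transversals s t (λ p p′ → agreement false (χ p p′)) (λ α β iα iβ → balanced α β iα iβ false)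
    (λ i → node (place h q i)) (λ j → node (place h′ q′ j)) (nodes-injective h q same) (nodes-injective h′ q′ same′)
  -- For the bit `true`, `hit` reads `χ` with the node of the head first, so the two sequences
  -- change roles.
  dense h h′ q q′ same same′ true = ≤-trans
    (balanced-on-transversals s t (λ p p′ → agreement true (χ p p′)) (λ α β iα iβ → balanced α β iα iβ true)
      (λ j → node (place h′ q′ j)) (λ i → node (place h q i)) (nodes-injective h′ q′ same′) (nodes-injective h q same))
    (≤-reflexive (cong (4 *_) (∑-comm {r} {r} _)))

  -- Otherwise the blocks `bottom h`, `top h`, `bottom h′` and `top h′` coincide, and both levels
  -- have their middle quarters in one block. Comparing the medians puts a quarter of one level
  -- entirely before a quarter of the other, and balance yields an edge mapped against its arc.
  bottom<top : ∀ h h′ → toℕ h′ ≡ suc (toℕ h) → bottom h < top h′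
  bottom<top h h′ next = ≰⇒> impossible
    where
    impossible : ¬ top h′ ≤ bottom h
    impossible le = contra (≤-total (threshold h q₂) (threshold h′ q₂))
      where
      link≤ = top≤bottom h h′ next
      bt : ∀ h → bottom h ≤ top h
      bt h = block-mono (threshold-mono h q₁ q₃ (s≤s (s≤s z≤n)))
      pin : ∀ {x} → bottom h ≤ x → x ≤ top h′ → x ≡ bottom h
      pin lo hi = ≤-antisym (≤-trans hi le) lo
      low : ∀ a → threshold h q₁ ≤ a → a ≤ threshold h q₃ → block a ≡ bottom h
      low a lo hi = pin (block-mono lo) (≤-trans (block-mono hi) (≤-trans link≤ (bt h′)))
      high : ∀ a → threshold h′ q₁ ≤ a → a ≤ threshold h′ q₃ → block a ≡ bottom h
      high a lo hi = pin (≤-trans (bt h) (≤-trans link≤ (block-mono lo))) (block-mono hi)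
      1<2 : toℕ q₁ < toℕ q₂
      1<2 = s≤s (s≤s z≤n)
      2<3 : toℕ q₂ < toℕ q₃
      2<3 = s≤s (s≤s (s≤s z≤n))
      contra : ¬ (threshold h q₂ ≤ threshold h′ q₂ ⊎ threshold h′ q₂ ≤ threshold h q₂)
      -- The second quarter of `h` precedes the third quarter of `h′`: an arc between them needs `χ`
      -- true, but the hit found has `χ` false.
      contra (inj₁ before) = contradiction (trans (sym is-hit) (cong not χ≡)) λ ()
        where
        open Arc (find-arc node false h h′ q₁ q₂ next
          (threshold-≤ h q₁) (λ i → place-< h q₁ q₂ i first 1<2) (threshold-≤ h′ q₂) (λ i → place-< h′ q₂ q₃ i first 2<3)
          (dense h h′ q₁ q₂
            (λ i → low _ (threshold-≤ h q₁ i) (≤-trans (<⇒≤ (place-< h q₁ q₂ i first 1<2)) (threshold-mono h q₂ q₃ 2<3)))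
            (λ i → high _ (≤-trans (threshold-mono h′ q₁ q₂ 1<2) (threshold-≤ h′ q₂ i)) (<⇒≤ (place-< h′ q₂ q₃ i first 2<3)))
            false))
        χ≡ : χ (node a) (node b) ≡ true
        χ≡ = arc-node-< (<-≤-trans a<hi (≤-trans before lo′≤b))
          (trans (low a lo≤a (≤-trans (<⇒≤ a<hi) (threshold-mono h q₂ q₃ 2<3)))
                 (sym (high b (≤-trans (threshold-mono h′ q₁ q₂ 1<2) lo′≤b) (<⇒≤ b<hi′)))) is-arc
      -- The third quarter of `h` follows the second quarter of `h′`, so the arc needs `χ` false at
      -- the node of the head and the node of the tail.
      contra (inj₂ after) = contradiction (trans (sym is-hit) χ≡) λ ()
        where
        open Arc (find-arc node true h h′ q₂ q₁ next
          (threshold-≤ h q₂) (λ i → place-< h q₂ q₃ i first 2<3) (threshold-≤ h′ q₁) (λ i → place-< h′ q₁ q₂ i first 1<2)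
          (dense h h′ q₂ q₁
            (λ i → low _ (≤-trans (threshold-mono h q₁ q₂ 1<2) (threshold-≤ h q₂ i)) (<⇒≤ (place-< h q₂ q₃ i first 2<3)))
            (λ i → high _ (threshold-≤ h′ q₁ i) (≤-trans (<⇒≤ (place-< h′ q₁ q₂ i first 1<2)) (threshold-mono h′ q₂ q₃ 2<3)))
            true))
        χ≡ : χ (node b) (node a) ≡ false
        χ≡ = arc-node-> (<-≤-trans b<hi′ (≤-trans after lo≤a))
          (trans (low a (≤-trans (threshold-mono h q₁ q₂ 1<2) lo≤a) (<⇒≤ a<hi))
                 (sym (high b lo′≤b (≤-trans (<⇒≤ b<hi′) (threshold-mono h′ q₂ q₃ 2<3))))) is-arc

  -- Two levels gain a block: the first step gives `top h₀ ≤ bottom h₁`, and the second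
  -- `bottom h₁ < top h`.
  climb : ∀ j h → toℕ h ≡ j → j ≤ 2 * top h
  climb zero          h h≡ = z≤n
  climb (suc zero)    h h≡ = ≤-trans (≤-trans (s≤s z≤n) (bottom<top h₀ h (trans h≡ (cong suc (sym (toℕ-fromℕ< _)))))) (m≤n*m (top h) 2)
    where h₀ = fromℕ< (≤-trans (s≤s z≤n) 2≤H)
  climb (suc (suc j)) h h≡ = begin
    2 + j            ≤⟨ +-monoʳ-≤ 2 (climb j h₀ h₀≡) ⟩
    2 + 2 * top h₀   ≤⟨ +-monoʳ-≤ 2 (*-monoʳ-≤ 2 (top≤bottom h₀ h₁ (trans h₁≡ (cong suc (sym h₀≡))))) ⟩
    2 + 2 * bottom h₁ ≡⟨ *-suc 2 (bottom h₁) ⟨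
    2 * suc (bottom h₁) ≤⟨ *-monoʳ-≤ 2 (bottom<top h₁ h (trans h≡ (cong suc (sym h₁≡)))) ⟩
    2 * top h        ∎
    where
    open ≤-Reasoning
    h<H : suc (suc j) < H
    h<H = subst (_< H) h≡ (toℕ<n h)
    h₁ = fromℕ< (<⇒≤ h<H)
    h₀ = fromℕ< (<⇒≤ (<⇒≤ h<H))
    h₁≡ = toℕ-fromℕ< (<⇒≤ h<H)
    h₀≡ = toℕ-fromℕ< (<⇒≤ (<⇒≤ h<H))

  -- For the last level, `climb` gives `H ≤ 1 + 2 * top h`, while the bound on `N` gives
  -- `4 * top h < H`. Together they force `top h` to be 0 and `H` to be at most 1.
  contradictory : ⊥
  contradictory = <⇒≱ 2≤H (begin
    H                 ≤⟨ H≤ ⟩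
    1 + 2 * top h     ≡⟨ cong (λ x → 1 + 2 * x) top≡0 ⟩
    1                 ∎)
    where
    open ≤-Reasoning
    0<H = ≤-trans (s≤s z≤n) 2≤H
    h : Fin H
    h = fromℕ< {pred H} (≤-reflexive (suc-pred H {{>-nonZero 0<H}}))
    H≤ : H ≤ 1 + 2 * top h
    H≤ = ≤-trans (≤-reflexive (sym (suc-pred H {{>-nonZero 0<H}}))) (s≤s (climb _ h (toℕ-fromℕ< _)))
    lemma : ∀ c z → 4 * (c * z) ≡ (4 * c) * z
    lemma = solve-∀
    lemma′ : ∀ c → 4 * c ≡ 2 * c + 2 * c
    lemma′ = solve-∀
    4top< : 4 * top h < 1 + 2 * top h
    4top< = *-cancelʳ-< (k * t) (4 * top h) _ (begin-strict
      4 * top h * (k * t)           ≡⟨ lemma (top h) (k * t) ⟨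
      4 * (top h * (k * t))         ≤⟨ *-monoʳ-≤ 4 (block-bound (threshold h q₃)) ⟩
      4 * threshold h q₃ <⟨ *-monoʳ-< 4 (toℕ<n (f (combine h (member h q₃ first)))) ⟩
      4 * N                         ≤⟨ N≤ ⟩
      H * (k * t)                   ≤⟨ *-monoˡ-≤ (k * t) H≤ ⟩
      (1 + 2 * top h) * (k * t)     ∎)
    top≡0 : top h ≡ 0
    top≡0 = m*n≡0⇒n≡0 (n<1⇒n≡0 (+-cancelʳ-< (2 * top h) _ _ (subst (_< 1 + 2 * top h) (lemma′ (top h)) 4top<)))
      where
      m*n≡0⇒n≡0 : 2 * top h ≡ 0 → top h ≡ 0
      m*n≡0⇒n≡0 eq with m*n≡0⇒m≡0∨n≡0 2 eq
      ... | inj₂ z = z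

-- Bernoulli inequalities and exponential growth.

*-swap-left : ∀ a b c → a * (b * c) ≡ b * (a * c)
*-swap-left = solve-∀

-- Bernoulli's inequality `(1 + 1 / x) ^ j ≥ 1 + j / x`, cleared of denominators.
bernoulli : ∀ x j → x ^ j * (x + j) ≤ suc x ^ j * x
bernoulli x zero    = ≤-reflexive (cong (λ y → 1 * y) (+-identityʳ x))
bernoulli x (suc j) = begin
  x * x ^ j * (x + suc j)          ≡⟨ lemma₁ x (x ^ j) (x + suc j) ⟩
  x ^ j * (x * (x + suc j))        ≤⟨ *-monoʳ-≤ (x ^ j) (≤-trans (m≤m+n _ j) (≤-reflexive (lemma₂ x j))) ⟩
  x ^ j * (suc x * (x + j))        ≡⟨ *-swap-left (x ^ j) (suc x) (x + j) ⟩
  suc x * (x ^ j * (x + j))        ≤⟨ *-monoʳ-≤ (suc x) (bernoulli x j) ⟩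
  suc x * (suc x ^ j * x)          ≡⟨ *-assoc (suc x) (suc x ^ j) x ⟨
  suc x * suc x ^ j * x            ∎
  where
  open ≤-Reasoning
  lemma₁ : ∀ a b c → a * b * c ≡ b * (a * c)
  lemma₁ = solve-∀
  lemma₂ : ∀ x j → x * (x + suc j) + j ≡ suc x * (x + j)
  lemma₂ = solve-∀

-- Bernoulli at the exponent `suc x`. It means that `suc x` random points all miss a set of density
-- `1 / suc x` with probability at most one half.
2*x^[1+x]≤[1+x]^[1+x] : ∀ x .{{_ : NonZero x}} → 2 * x ^ suc x ≤ suc x ^ suc x
2*x^[1+x]≤[1+x]^[1+x] x = *-cancelʳ-≤ _ _ x (begin
  2 * x ^ suc x * x       ≡⟨ lemma (x ^ suc x) x ⟩
  x ^ suc x * (x + x)     ≤⟨ *-monoʳ-≤ (x ^ suc x) (+-monoʳ-≤ x (n≤1+n x)) ⟩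
  x ^ suc x * (x + suc x) ≤⟨ bernoulli x (suc x) ⟩
  suc x ^ suc x * x       ∎)
  where
  open ≤-Reasoning
  lemma : ∀ a b → 2 * a * b ≡ a * (b + b)
  lemma = solve-∀

-- The upper bound `(1 + 1 / x) ^ j ≤ x / (x - j)`, cleared of denominators; `y` replaces `x - j` to
-- avoid truncated subtraction.
bernoulli-inverse : ∀ {x} j y → j + y ≡ x → suc x ^ j * y ≤ x ^ j * x
bernoulli-inverse     zero    y refl = ≤-refl
bernoulli-inverse {x} (suc j) y eq = begin
  suc x * suc x ^ j * y         ≡⟨ lemma (suc x) (suc x ^ j) y ⟩
  suc x ^ j * (suc x * y)       ≤⟨ *-monoʳ-≤ (suc x ^ j) (≤-trans (+-monoˡ-≤ (x * y) y≤x) (≤-reflexive (sym (*-suc x y)))) ⟩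
  suc x ^ j * (x * suc y)       ≡⟨ *-swap-left (suc x ^ j) x (suc y) ⟩
  x * (suc x ^ j * suc y)       ≤⟨ *-monoʳ-≤ x (bernoulli-inverse j (suc y) (trans (+-suc j y) eq)) ⟩
  x * (x ^ j * x)               ≡⟨ *-assoc x (x ^ j) x ⟨
  x * x ^ j * x                 ∎
  where
  open ≤-Reasoning
  lemma : ∀ a b c → a * b * c ≡ b * (a * c)
  lemma = solve-∀
  y≤x : y ≤ x
  y≤x = ≤-trans (m≤n+m y (suc j)) (≤-reflexive eq)

[1+2b]^b≤2*[2b]^b : ∀ b .{{_ : NonZero b}} → suc (b + b) ^ b ≤ 2 * (b + b) ^ b
[1+2b]^b≤2*[2b]^b b = *-cancelʳ-≤ _ _ b (≤-trans (bernoulli-inverse b b refl) (≤-reflexive (lemma ((b + b) ^ b) b)))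
  where
  lemma : ∀ a b → a * (b + b) ≡ 2 * a * b
  lemma = solve-∀

-- With `c = 1 + 1 / (2 * b)`, `c ^ b ≤ 2` gives `c ^ Δ ≤ c ^ (b * q) ≤ 2 ^ q`. The factor `x ^ d`
-- pads the exponent to `b * q`.
growth-bound : ∀ b .{{_ : NonZero b}} q Δ → Δ ≤ b * q → suc (b + b) ^ Δ ≤ 2 ^ q * (b + b) ^ Δ
growth-bound b@(suc _) q Δ Δ≤ = *-cancelʳ-≤ _ _ (x ^ d) {{m^n≢0 x d}} (begin
  suc x ^ Δ * x ^ d            ≤⟨ *-monoʳ-≤ (suc x ^ Δ) (^-monoˡ-≤ d (n≤1+n x)) ⟩
  suc x ^ Δ * suc x ^ d        ≡⟨ ^-distribˡ-+-* (suc x) Δ d ⟨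
  suc x ^ (Δ + d)              ≡⟨ cong (suc x ^_) (m+[n∸m]≡n Δ≤) ⟩
  suc x ^ (b * q)              ≡⟨ ^-*-assoc (suc x) b q ⟨
  (suc x ^ b) ^ q              ≤⟨ ^-monoˡ-≤ q ([1+2b]^b≤2*[2b]^b b) ⟩
  (2 * x ^ b) ^ q              ≡⟨ trans (^-swap 2 (x ^ b) q) (*-comm ((x ^ b) ^ q) (2 ^ q)) ⟩
  2 ^ q * (x ^ b) ^ q          ≡⟨ cong (2 ^ q *_) (^-*-assoc x b q) ⟩
  2 ^ q * x ^ (b * q)          ≡⟨ cong (λ z → 2 ^ q * x ^ z) (m+[n∸m]≡n Δ≤) ⟨
  2 ^ q * x ^ (Δ + d)          ≡⟨ cong (2 ^ q *_) (^-distribˡ-+-* x Δ d) ⟩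
  2 ^ q * (x ^ Δ * x ^ d)      ≡⟨ *-assoc (2 ^ q) _ _ ⟨
  2 ^ q * x ^ Δ * x ^ d        ∎)
  where
  open ≤-Reasoning
  x = b + b
  d = b * q ∸ Δ

-- Passing between rational and natural inequalities.

toℚᵘ-ℕtoℚ : ∀ a → ℚ.toℚᵘ (ℕtoℚ a) ℚᵘ.≃ ℚᵘ.mkℚᵘ (pos a) 0
toℚᵘ-ℕtoℚ a = ℚ.toℚᵘ-fromℚᵘ (ℚᵘ.mkℚᵘ (pos a) 0)

ℕtoℚ-* : ∀ a b → ℕtoℚ (a * b) ≡ ℕtoℚ a ℚ.* ℕtoℚ b
ℕtoℚ-* a b = ℚ.toℚᵘ-injective (begin
  ℚ.toℚᵘ (ℕtoℚ (a * b))                   ≈⟨ toℚᵘ-ℕtoℚ (a * b) ⟩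
  ℚᵘ.mkℚᵘ (pos (a * b)) 0                   ≈⟨ ℚᵘ.*≡* (cong (ℤ._* pos 1) (ℤ.pos-* a b)) ⟩
  ℚᵘ.mkℚᵘ (pos a) 0 ℚᵘ.* ℚᵘ.mkℚᵘ (pos b) 0    ≈⟨ ℚᵘ.*-cong (toℚᵘ-ℕtoℚ a) (toℚᵘ-ℕtoℚ b) ⟨
  ℚ.toℚᵘ (ℕtoℚ a) ℚᵘ.* ℚ.toℚᵘ (ℕtoℚ b)    ≈⟨ ℚ.toℚᵘ-homo-* (ℕtoℚ a) (ℕtoℚ b) ⟨
  ℚ.toℚᵘ (ℕtoℚ a ℚ.* ℕtoℚ b)              ∎)
  where open ℚᵘ.≃-Reasoning

ℕtoℚ-cancel-≤ : ∀ {a b} → ℕtoℚ a ℚ.≤ ℕtoℚ b → a ≤ b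
ℕtoℚ-cancel-≤ {a} {b} le with ℚᵘ.≤-respˡ-≃ (toℚᵘ-ℕtoℚ a) (ℚᵘ.≤-respʳ-≃ (toℚᵘ-ℕtoℚ b) (ℚ.toℚᵘ-mono-≤ le))
... | ℚᵘ.*≤* le′ = ℤ.drop‿+≤+ (ℤ.*-cancelʳ-≤-pos (pos a) (pos b) (pos 1) le′)

ℕtoℚ-mono-≤ : ∀ {a b} → a ≤ b → ℕtoℚ a ℚ.≤ ℕtoℚ b
ℕtoℚ-mono-≤ {a} {b} le = ℚ.toℚᵘ-cancel-≤ (ℚᵘ.≤-respˡ-≃ (ℚᵘ.≃-sym (toℚᵘ-ℕtoℚ a)) (ℚᵘ.≤-respʳ-≃ (ℚᵘ.≃-sym (toℚᵘ-ℕtoℚ b))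
  (ℚᵘ.*≤* (ℤ.*-monoʳ-≤-nonNeg (pos 1) (ℤ.+≤+ le)))))

ℕtoℚ-mono-< : ∀ {a b} → a < b → ℕtoℚ a ℚ.< ℕtoℚ b
ℕtoℚ-mono-< {a} {b} lt = ℚ.≰⇒> λ ge → <⇒≱ lt (ℕtoℚ-cancel-≤ ge)

ℕtoℚ-nonNegative : ∀ a → ℚ.NonNegative (ℕtoℚ a)
ℕtoℚ-nonNegative a = ℚ.nonNegative (ℕtoℚ-mono-≤ {0} {a} z≤n)

successor-ratio : ∀ x .{{_ : NonZero x}} → ℚ
successor-ratio x = pos (suc x) ℚ./ x

successor-ratio-* : ∀ x .{{_ : NonZero x}} → successor-ratio x ℚ.* ℕtoℚ x ≡ ℕtoℚ (suc x)
successor-ratio-* x@(suc y) = ℚ.toℚᵘ-injective (begin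
  ℚ.toℚᵘ (successor-ratio x ℚ.* ℕtoℚ x)             ≈⟨ ℚ.toℚᵘ-homo-* (successor-ratio x) (ℕtoℚ x) ⟩
  ℚ.toℚᵘ (successor-ratio x) ℚᵘ.* ℚ.toℚᵘ (ℕtoℚ x)   ≈⟨ ℚᵘ.*-cong (ℚ.toℚᵘ-fromℚᵘ (ℚᵘ.mkℚᵘ (pos (suc x)) y)) (toℚᵘ-ℕtoℚ x) ⟩
  ℚᵘ.mkℚᵘ (pos (suc x)) y ℚᵘ.* ℚᵘ.mkℚᵘ (pos x) 0          ≈⟨ ℚᵘ.*≡* (trans (ℤ.*-identityʳ _) (cong (λ z → pos (suc x) ℤ.* pos (suc z)) (sym (*-identityʳ y)))) ⟩
  ℚᵘ.mkℚᵘ (pos (suc x)) 0                               ≈⟨ toℚᵘ-ℕtoℚ (suc x) ⟨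
  ℚ.toℚᵘ (ℕtoℚ (suc x))                             ∎)
  where open ℚᵘ.≃-Reasoning

1<successor-ratio : ∀ x .{{_ : NonZero x}} → 1ℚ ℚ.< successor-ratio x
1<successor-ratio x = ℚ.*-cancelʳ-<-nonNeg (ℕtoℚ x) {{ℕtoℚ-nonNegative x}}
  (subst₂ ℚ._<_ (sym (ℚ.*-identityˡ (ℕtoℚ x))) (sym (successor-ratio-* x)) (ℕtoℚ-mono-< (n<1+n x)))

successor-ratio-^ : ∀ x .{{_ : NonZero x}} Δ → (successor-ratio x ^ℚ Δ) ℚ.* ℕtoℚ (x ^ Δ) ≡ ℕtoℚ (suc x ^ Δ)
successor-ratio-^ x zero    = refl
successor-ratio-^ x (suc Δ) = begin
  c ℚ.* (c ^ℚ Δ) ℚ.* ℕtoℚ (x * x ^ Δ)             ≡⟨ cong (c ℚ.* (c ^ℚ Δ) ℚ.*_) (ℕtoℚ-* x (x ^ Δ)) ⟩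
  c ℚ.* (c ^ℚ Δ) ℚ.* (ℕtoℚ x ℚ.* ℕtoℚ (x ^ Δ))    ≡⟨ ℚ.*-assoc c (c ^ℚ Δ) _ ⟩
  c ℚ.* ((c ^ℚ Δ) ℚ.* (ℕtoℚ x ℚ.* ℕtoℚ (x ^ Δ)))  ≡⟨ cong (c ℚ.*_) (trans (sym (ℚ.*-assoc (c ^ℚ Δ) _ _)) (trans (cong (ℚ._* ℕtoℚ (x ^ Δ)) (ℚ.*-comm (c ^ℚ Δ) (ℕtoℚ x))) (ℚ.*-assoc (ℕtoℚ x) _ _))) ⟩
  c ℚ.* (ℕtoℚ x ℚ.* ((c ^ℚ Δ) ℚ.* ℕtoℚ (x ^ Δ)))  ≡⟨ ℚ.*-assoc c (ℕtoℚ x) _ ⟨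
  c ℚ.* ℕtoℚ x ℚ.* ((c ^ℚ Δ) ℚ.* ℕtoℚ (x ^ Δ))    ≡⟨ cong₂ ℚ._*_ (successor-ratio-* x) (successor-ratio-^ x Δ) ⟩
  ℕtoℚ (suc x) ℚ.* ℕtoℚ (suc x ^ Δ)               ≡⟨ ℕtoℚ-* (suc x) (suc x ^ Δ) ⟨
  ℕtoℚ (suc x * suc x ^ Δ)                        ∎
  where
  open ≡-Reasoning
  c = successor-ratio x

-- Multiplying by `(b + b) ^ Δ` clears the denominator of the power, and `growth-bound` applies in
-- the naturals.
successor-ratio-≤ : ∀ b .{{_ : NonZero b}} .{{_ : NonZero (b + b)}} q Δ H n N → Δ ≤ b * q →
  ℕtoℚ N ℚ.≤ (successor-ratio (b + b) ^ℚ Δ) ℚ.* ℕtoℚ H ℚ.* ℕtoℚ n → N ≤ 2 ^ q * (H * n)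
successor-ratio-≤ b q Δ H n N Δ≤ le = *-cancelʳ-≤ _ _ y {{m^n≢0 (b + b) Δ}} (begin
  N * y                      ≤⟨ ℕtoℚ-cancel-≤ le′ ⟩
  suc (b + b) ^ Δ * (H * n)  ≤⟨ *-monoˡ-≤ (H * n) (growth-bound b q Δ Δ≤) ⟩
  2 ^ q * y * (H * n)        ≡⟨ lemma (2 ^ q) y (H * n) ⟩
  2 ^ q * (H * n) * y        ∎)
  where
  open ≤-Reasoning
  y = (b + b) ^ Δ
  c^Δ = successor-ratio (b + b) ^ℚ Δ
  lemma : ∀ a b c → a * b * c ≡ a * c * b
  lemma = solve-∀
  le′ : ℕtoℚ (N * y) ℚ.≤ ℕtoℚ (suc (b + b) ^ Δ * (H * n))
  le′ = subst₂ ℚ._≤_ (sym (ℕtoℚ-* N y))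
    (trans (cong (ℚ._* ℕtoℚ y) (trans (ℚ.*-assoc c^Δ _ _) (cong (c^Δ ℚ.*_) (sym (ℕtoℚ-* H n)))))
    (trans (ℚ.*-assoc c^Δ _ _) (trans (cong (c^Δ ℚ.*_) (ℚ.*-comm (ℕtoℚ (H * n)) (ℕtoℚ y)))
    (trans (sym (ℚ.*-assoc c^Δ _ _)) (trans (cong (ℚ._* ℕtoℚ (H * n)) (successor-ratio-^ (b + b) Δ)) (sym (ℕtoℚ-* (suc (b + b) ^ Δ) (H * n))))))))
    (ℚ.*-monoʳ-≤-nonNeg (ℕtoℚ y) {{ℕtoℚ-nonNegative y}} le)

-- Parameters for which the union bounds hold.

tests-2^ : ∀ a n → tests (2 ^ a) n ≡ 2 ^ suc (a * n + a * n)
tests-2^ a n = begin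
  (2 ^ a) ^ n * ((2 ^ a) ^ n * 2)  ≡⟨ cong (λ x → x * (x * 2)) (^-*-assoc 2 a n) ⟩
  2 ^ (a * n) * (2 ^ (a * n) * 2)  ≡⟨ lemma (2 ^ (a * n)) ⟩
  2 * (2 ^ (a * n) * 2 ^ (a * n))  ≡⟨ cong (2 *_) (^-distribˡ-+-* 2 (a * n) (a * n)) ⟨
  2 ^ suc (a * n + a * n)          ∎
  where
  open ≡-Reasoning
  lemma : ∀ x → x * (x * 2) ≡ 2 * (x * x)
  lemma = solve-∀

tests-mono : ∀ {k k′} n → k ≤ k′ → tests k n ≤ tests k′ n
tests-mono n le = *-mono-≤ (^-monoˡ-≤ n le) (*-monoˡ-≤ 2 (^-monoˡ-≤ n le))

-- By `3 ^ 5 < 2 ^ 8`, the left side is at most 2 to the power `1 + 160 q² + 2560 q²`, while the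
-- exponent on the right is at least `1200 q² + 1600 q²`. The factor 40 in `s` makes the gap,
-- quadratic in `s`, exceed the cost of the tests, linear in `s`.
few-matrix-tests : ∀ q .{{_ : NonZero q}} → let s = q * 40 in ∀ y → 3 * (s * s) ≤ 4 * y →
  tests (2 ^ (q + q)) s * 3 ^ (s * s) < 2 ^ y * 2 ^ (s * s)
few-matrix-tests q y 3ss≤4y = begin-strict
  tests (2 ^ (q + q)) s * 3 ^ (s * s)
    ≡⟨ cong₂ _*_ (trans (tests-2^ (q + q) s) (cong (λ x → 2 ^ suc x) (double q))) (cong (3 ^_) (square₅ q)) ⟩
  2 ^ suc (q * q * 160) * 3 ^ (5 * (q * q * 320))
    ≡⟨ cong (2 ^ suc (q * q * 160) *_) (^-*-assoc 3 5 (q * q * 320)) ⟨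
  2 ^ suc (q * q * 160) * 243 ^ (q * q * 320)
    ≤⟨ *-monoʳ-≤ (2 ^ suc (q * q * 160)) (^-monoˡ-≤ (q * q * 320) (≤ᵇ⇒≤ 243 256 tt)) ⟩
  2 ^ suc (q * q * 160) * 256 ^ (q * q * 320)
    ≡⟨ cong (2 ^ suc (q * q * 160) *_) (^-*-assoc 2 8 (q * q * 320)) ⟩
  2 ^ suc (q * q * 160) * 2 ^ (8 * (q * q * 320))
    ≡⟨ ^-distribˡ-+-* 2 (suc (q * q * 160)) (8 * (q * q * 320)) ⟨
  2 ^ (suc (q * q * 160) + 8 * (q * q * 320))
    <⟨ ^-monoʳ-< 2 (s≤s (s≤s z≤n)) exponents ⟩
  2 ^ (y + s * s)
    ≡⟨ ^-distribˡ-+-* 2 y (s * s) ⟩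
  2 ^ y * 2 ^ (s * s) ∎
  where
  open ≤-Reasoning
  s = q * 40
  double : ∀ q → (q + q) * (q * 40) + (q + q) * (q * 40) ≡ q * q * 160
  double = solve-∀
  square₅ : ∀ q → (q * 40) * (q * 40) ≡ 5 * (q * q * 320)
  square₅ = solve-∀
  lemma₁ : ∀ x → 4 * (suc (x * 160) + 8 * (x * 320)) ≡ 4 + x * 10880
  lemma₁ = solve-∀
  lemma₂ : ∀ q → q * q * 11200 ≡ 3 * ((q * 40) * (q * 40)) + 4 * ((q * 40) * (q * 40))
  lemma₂ = solve-∀
  lemma₃ : ∀ x → x * 320 + x * 10880 ≡ x * 11200
  lemma₃ = solve-∀
  5≤ : 5 ≤ q * q * 320
  5≤ = ≤-trans (≤ᵇ⇒≤ 5 320 tt) (m≤n*m 320 (q * q) {{m*n≢0 q q}})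
  exponents : suc (q * q * 160) + 8 * (q * q * 320) < y + s * s
  exponents = *-cancelˡ-< 4 _ _ (begin-strict
    4 * (suc (q * q * 160) + 8 * (q * q * 320))  ≡⟨ lemma₁ (q * q) ⟩
    4 + q * q * 10880                            <⟨ +-monoˡ-< (q * q * 10880) 5≤ ⟩
    q * q * 320 + q * q * 10880                  ≡⟨ lemma₃ (q * q) ⟩
    q * q * 11200                                ≡⟨ lemma₂ q ⟩
    3 * (s * s) + 4 * (s * s)                    ≤⟨ +-monoˡ-≤ (4 * (s * s)) 3ss≤4y ⟩
    4 * y + 4 * (s * s)                          ≡⟨ *-distribˡ-+ 4 y (s * s) ⟨
    4 * (y + s * s)                              ∎)

-- Each group of `suc γ` points halves the probability of missing a dense set. There are
-- `n * suc q * 4` groups, and at most 2 to the power `1 + 2 * (2 * q + 1) * n` tests, since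
-- `suc (2 ^ (q + q))` labels are at most `2 ^ suc (q + q)`.
few-edge-tests : ∀ γ .{{_ : NonZero γ}} q n .{{_ : NonZero n}} → let m = suc γ * (n * suc q * 4) in
  tests (suc (2 ^ (q + q))) n * γ ^ m < suc γ ^ m
few-edge-tests γ q n = begin-strict
  tests (suc (2 ^ (q + q))) n * γ ^ m     ≤⟨ *-monoˡ-≤ (γ ^ m) (tests-mono n (+-mono-≤ (m^n>0 2 (q + q)) (≤-reflexive (sym (+-identityʳ _))))) ⟩
  tests (2 ^ suc (q + q)) n * γ ^ m       ≡⟨ cong (_* γ ^ m) (tests-2^ (suc (q + q)) n) ⟩
  2 ^ suc (x + x) * γ ^ m                 <⟨ *-monoˡ-< (γ ^ m) {{m^n≢0 γ m}} (^-monoʳ-< 2 (s≤s (s≤s z≤n)) exponents) ⟩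
  2 ^ j * γ ^ m                           ≡⟨ trans (cong (2 ^ j *_) (sym (^-*-assoc γ (suc γ) j))) (trans (*-comm (2 ^ j) _) (sym (^-swap 2 (γ ^ suc γ) j))) ⟩
  (2 * γ ^ suc γ) ^ j                     ≤⟨ ^-monoˡ-≤ j (2*x^[1+x]≤[1+x]^[1+x] γ) ⟩
  (suc γ ^ suc γ) ^ j                     ≡⟨ ^-*-assoc (suc γ) (suc γ) j ⟩
  suc γ ^ m                               ∎
  where
  open ≤-Reasoning
  j = n * suc q * 4
  m = suc γ * j
  x = suc (q + q) * n
  lemma : ∀ q n → (n + n) + (suc (q + q) * n + suc (q + q) * n) ≡ n * suc q * 4
  lemma = solve-∀
  exponents : suc (x + x) < j
  exponents = begin-strict
    1 + (x + x)        <⟨ n<1+n _ ⟩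
    2 + (x + x)        ≤⟨ +-monoˡ-≤ (x + x) (+-mono-≤ (>-nonZero⁻¹ n) (>-nonZero⁻¹ n)) ⟩
    (n + n) + (x + x)  ≡⟨ lemma q n ⟩
    j                  ∎

linear≤exponential : ∀ c a .{{_ : NonZero a}} → a * c ≤ 2 ^ a → ∀ i → (i + a) * c ≤ 2 ^ (i + a)
linear≤exponential c a base zero    = base
linear≤exponential c a base (suc i) = begin
  c + (i + a) * c            ≤⟨ +-monoˡ-≤ ((i + a) * c) (m≤n*m c (i + a) {{>-nonZero (≤-trans (>-nonZero⁻¹ a) (m≤n+m a i))}}) ⟩
  (i + a) * c + (i + a) * c  ≡⟨ cong ((i + a) * c +_) (+-identityʳ _) ⟨
  2 * ((i + a) * c)          ≤⟨ *-monoʳ-≤ 2 (linear≤exponential c a base i) ⟩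
  2 * 2 ^ (i + a)            ∎
  where open ≤-Reasoning

-- Choosing the parameters and the constants.

-- The graph does not depend on `N`; only the tournament avoiding it does.
pseudorandom-graph-avoidable : ∀ {k s t m n Δ H} .{{_ : NonZero k}} .{{_ : NonZero s}} .{{_ : NonZero t}} .{{_ : NonZero Δ}}
  (e : Fin m → Fin n × Fin n) (χ : Fin k → Fin k → Bool) →
  (∀ (α β : Fin s → Fin k) → Injective _≡_ _≡_ α → Injective _≡_ _≡_ β →
    ∀ c → s * s ≤ 4 * sum λ i → sum λ j → agreement c (χ (α i) (β j))) →
  (∀ (a b : Fin n → Fin (suc k)) c → (s * t) * (s * t) ≤ 4 * sum (λ u → sum λ v → ind (hit χ c (a u) (b v))) →
    ∃ λ i → hit χ c (a (proj₁ (e i))) (b (proj₂ (e i))) ≡ true) →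
  8 ≤ n → 16 * m ≤ Δ * n → 8 * (s * t) ≤ n → Δ ≤ n → 2 ≤ H →
  Σ Digraph λ G → Σ (Fin (size G) → Fin H) λ level → IsGradedPartition G H level × MaxDegree G Δ ×
    (∀ i → partSize G level i ≤ n) × size G ≡ H * n × (∀ N → 4 * N ≤ H * (k * t) → ¬ Forces G N)
pseudorandom-graph-avoidable {k} {s} {t} {m} {n} {Δ} {H} e χ balanced hits 8≤n few 8st≤n Δ≤n 2≤H =
  G , level , graded , maxDegree (>-nonZero⁻¹ Δ) Δ≤n 2≤H , partSize-level , refl , λ N N≤ forces →
    NoCopy.contradictory {H} {n} {Δ} {m} {k} {s} {t} {N} e χ balanced hits many-kept 2≤H N≤
      (forces (BlockTournament.tournament k t N χ) (BlockTournament.isTournament k t N χ))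
  where
  open GradedGraph H n Δ m e
  many-kept : 4 * (s * t) ≤ sum (ind ∘ kept)
  many-kept = *-cancelˡ-≤ 2 (≤-trans (≤-reflexive (sym (*-assoc 2 4 (s * t)))) (≤-trans 8st≤n (most-kept 8≤n few)))

-- Rounding down to a positive multiple of `d` loses less than `d`, hence at most half.
n≤2*[n/d*d] : ∀ n d .{{_ : NonZero d}} → d ≤ n → n ≤ 2 * (n / d * d)
n≤2*[n/d*d] n d d≤n = begin
  n                             ≡⟨ m≡m%n+[m/n]*n n d ⟩
  n % d + n / d * d             ≤⟨ +-mono-≤ (≤-trans (<⇒≤ (m%n<n n d)) (m≤n*m d (n / d) {{>-nonZero (m≥n⇒m/n>0 d≤n)}}))
                                            (m≤m+n (n / d * d) 0) ⟩
  2 * (n / d * d)               ∎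
  where open ≤-Reasoning

ramsey-lower-bound : ∀ q Δ n H → 16 ≤ q → q * 65536 + 65536 ≤ Δ → Δ ≤ n → 2 ≤ H →
  Σ Digraph λ G → Σ (Fin (size G) → Fin H) λ level → IsGradedPartition G H level × MaxDegree G Δ ×
    (∀ i → partSize G level i ≤ n) × size G ≡ H * n × (∀ N → N ≤ 2 ^ q * (H * n) → ¬ Forces G N)
ramsey-lower-bound q Δ n H 16≤q q≤Δ Δ≤n 2≤H =
  let (G , level , graded , maxDegree , parts , size≡ , avoids) =
        pseudorandom-graph-avoidable {{k≢0}} {{s≢0}} {{t≢0}} {{Δ≢0}} (proj₁ edges) (proj₁ matrix) (proj₂ matrix) hits 8≤n few 8st≤n Δ≤n 2≤H
  in G , level , graded , maxDegree , parts , size≡ , λ N N≤ → avoids N (small N N≤)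
  where
  open ≤-Reasoning
  -- One factor `2 ^ q` of `k` is the bound to be proved; the other pays for the factors lost, which
  -- are linear in `q`.
  k = 2 ^ (q + q)
  s = q * 40
  d = s * 8
  -- A quarter of the pairs between two sets of size `s * t`, at least `n / 16`, has density at
  -- least `1 / 1024`; hence 1024, used as `suc 1023`.
  m = 1024 * (n * suc q * 4)
  q≢0 = >-nonZero (≤-trans (s≤s z≤n) 16≤q)
  s≢0 = m*n≢0 q 40 {{q≢0}}
  d≢0 = m*n≢0 s 8 {{s≢0}}
  k≢0 = m^n≢0 2 (q + q)
  Δ≢0 = >-nonZero (≤-trans (≤-trans (≤ᵇ⇒≤ 1 65536 tt) (m≤n+m 65536 (q * 65536))) q≤Δ)
  n≢0 = >-nonZero (≤-trans (>-nonZero⁻¹ Δ {{Δ≢0}}) Δ≤n)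
  t = _/_ n d {{d≢0}}

  d≤n : d ≤ n
  d≤n = begin
    q * 40 * 8          ≡⟨ *-assoc q 40 8 ⟩
    q * 320             ≤⟨ *-monoʳ-≤ q (≤ᵇ⇒≤ 320 65536 tt) ⟩
    q * 65536           ≤⟨ m≤m+n (q * 65536) 65536 ⟩
    q * 65536 + 65536   ≤⟨ q≤Δ ⟩
    Δ                   ≤⟨ Δ≤n ⟩
    n                   ∎

  8≤n : 8 ≤ n
  8≤n = ≤-trans (m≤n*m 8 s {{s≢0}}) d≤n

  t≢0 = >-nonZero (m≥n⇒m/n>0 {{d≢0}} d≤n)

  matrix = balanced-matrix k s (few-matrix-tests q {{q≢0}})
  edges = pseudorandom-edges {n} {k} {{n≢0}} m 1023 (proj₁ matrix) (few-edge-tests 1023 q n {{n≢0}})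

  n≤16st : n ≤ 16 * (s * t)
  n≤16st = ≤-trans (n≤2*[n/d*d] n d {{d≢0}} d≤n) (≤-reflexive (lemma s t))
    where
    lemma : ∀ s t → 2 * (t * (s * 8)) ≡ 16 * (s * t)
    lemma = solve-∀

  hits : ∀ a b c → (s * t) * (s * t) ≤ 4 * sum (λ u → sum λ v → ind (hit (proj₁ matrix) c (a u) (b v))) →
    ∃ λ i → hit (proj₁ matrix) c (a (proj₁ (proj₁ edges i))) (b (proj₂ (proj₁ edges i))) ≡ true
  hits a b c dense = proj₂ edges a b c (density n (s * t) (sum λ u → sum λ v → ind (hit (proj₁ matrix) c (a u) (b v))) n≤16st dense)
    where
    density : ∀ n r w → n ≤ 16 * r → r * r ≤ 4 * w → n * n ≤ 1024 * w
    density n r w n≤16r dense = begin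
      n * n                  ≤⟨ *-mono-≤ n≤16r n≤16r ⟩
      16 * r * (16 * r)      ≡⟨ lemma r ⟩
      256 * (r * r)          ≤⟨ *-monoʳ-≤ 256 dense ⟩
      256 * (4 * w)          ≡⟨ *-assoc 256 4 w ⟨
      1024 * w               ∎
      where
      lemma : ∀ r → 16 * r * (16 * r) ≡ 256 * (r * r)
      lemma = solve-∀

  8st≤n : 8 * (s * t) ≤ n
  8st≤n = ≤-trans (≤-reflexive (lemma s t)) (m/n*n≤m n d {{d≢0}})
    where
    lemma : ∀ s t → 8 * (s * t) ≡ t * (s * 8)
    lemma = solve-∀

  few : 16 * m ≤ Δ * n
  few = scale 1024 65536 refl q≤Δ
    where
    -- The variable y stands for a numeral that conversion would otherwise unfold in unary.
    scale : ∀ a y → 16 * (a * 4) ≡ y → q * y + y ≤ Δ → 16 * (a * (n * suc q * 4)) ≤ Δ * n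
    scale a _ refl le = ≤-trans (≤-reflexive (lemma a q n)) (*-monoˡ-≤ n le)
      where
      lemma : ∀ a q n → 16 * (a * (n * suc q * 4)) ≡ (q * (16 * (a * 4)) + 16 * (a * 4)) * n
      lemma = solve-∀

  small : ∀ N → N ≤ 2 ^ q * (H * n) → 4 * N ≤ H * (k * t)
  small N N≤ = begin
    4 * N                                  ≤⟨ *-monoʳ-≤ 4 N≤ ⟩
    4 * (2 ^ q * (H * n))                  ≤⟨ *-monoʳ-≤ 4 (*-monoʳ-≤ (2 ^ q) (*-monoʳ-≤ H n≤16st)) ⟩
    4 * (2 ^ q * (H * (16 * (q * 40 * t)))) ≡⟨ lemma (2 ^ q) H q t ⟩
    H * (2 ^ q * (q * 2560) * t)           ≤⟨ *-monoʳ-≤ H (*-monoˡ-≤ t (*-monoʳ-≤ (2 ^ q) exponential)) ⟩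
    H * (2 ^ q * 2 ^ q * t)                ≡⟨ cong (λ x → H * (x * t)) (^-distribˡ-+-* 2 q q) ⟨
    H * (k * t)                            ∎
    where
    lemma : ∀ p H q t → 4 * (p * (H * (16 * (q * 40 * t)))) ≡ H * (p * (q * 2560) * t)
    lemma = solve-∀
    -- The constant 2560 is `4 * 16 * 40`. The inequality holds at 16, since 40960 is at most 65536,
    -- and persists from there on.
    exponential : q * 2560 ≤ 2 ^ q
    exponential = subst (λ x → x * 2560 ≤ 2 ^ x) (m∸n+n≡m 16≤q) (linear≤exponential 2560 16 (≤ᵇ⇒≤ 40960 65536 tt) (q ∸ 16))

-- Here `Δ` lies between `(q + 1) * d` and `(q + 2) * d`, and `q + 2 ≤ 2 * q`.
quotient-bounds : ∀ d .{{_ : NonZero d}} Δ q → suc q ≡ Δ / d → 2 ≤ q → q * d + d ≤ Δ × Δ ≤ (d + d) * q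
quotient-bounds d Δ q q≡ 2≤q = (begin
    q * d + d                ≡⟨ +-comm (q * d) d ⟩
    suc q * d                ≡⟨ cong (_* d) q≡ ⟩
    Δ / d * d                ≤⟨ m/n*n≤m Δ d ⟩
    Δ                        ∎) , (begin
    Δ                        ≡⟨ m≡m%n+[m/n]*n Δ d ⟩
    Δ % d + Δ / d * d        ≤⟨ +-monoˡ-≤ (Δ / d * d) (<⇒≤ (m%n<n Δ d)) ⟩
    d + Δ / d * d            ≡⟨ cong (λ x → d + x * d) q≡ ⟨
    d + (d + q * d)          ≡⟨ lemma₁ d q ⟩
    2 * d + q * d            ≤⟨ +-monoˡ-≤ (q * d) (*-monoˡ-≤ d 2≤q) ⟩
    q * d + q * d            ≡⟨ lemma₂ d q ⟩
    (d + d) * q              ∎)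
  where
  open ≤-Reasoning
  lemma₁ : ∀ d q → d + (d + q * d) ≡ 2 * d + q * d
  lemma₁ = solve-∀
  lemma₂ : ∀ d q → q * d + q * d ≡ (d + d) * q
  lemma₂ = solve-∀

theorem1p5 : Σ ℚ λ c → 1ℚ <ℚ c × Σ ℕ λ Δ₀ →
    ∀ (Δ n H : ℕ) → Δ₀ ≤ Δ → Δ ≤ n → 2 ≤ H →
    Σ Digraph λ G → Σ (Fin (size G) → Fin H) λ lvl →
    IsGradedPartition G H lvl × MaxDegree G Δ
    × (∀ i → partSize G lvl i ≤ n)
    × RamseyGreater G ((c ^ℚ Δ) *ℚ ℕtoℚ H *ℚ ℕtoℚ n)
    × ((c ^ℚ Δ) *ℚ ℕtoℚ (size G) ≤ℚ (c ^ℚ Δ) *ℚ ℕtoℚ H *ℚ ℕtoℚ n)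
theorem1p5 = c , 1<successor-ratio (b + b) , 17 * 65536 , λ Δ n H Δ₀≤Δ Δ≤n 2≤H →
  -- Subtracting 1 leaves room for the summand 65536 required beside `q * 65536`; the threshold 17 *
  -- 65536 for `Δ` makes `q` at least 16.
  let q = Δ / 65536 ∸ 1
      17≤ = ≤-trans (≤-reflexive (sym (m*n/n≡m 17 65536))) (/-monoˡ-≤ 65536 Δ₀≤Δ)
      16≤q = ∸-monoˡ-≤ 1 17≤
      (q≤ , Δ≤) = quotient-bounds 65536 Δ q (m+[n∸m]≡n (≤-trans (s≤s z≤n) 17≤)) (≤-trans (s≤s (s≤s z≤n)) 16≤q)
      (G , level , graded , maxDegree , parts , size≡ , lower) = ramsey-lower-bound q Δ n H 16≤q q≤ Δ≤n 2≤H
  in G , level , graded , maxDegree , parts ,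
     (λ N N≤ → lower N (successor-ratio-≤ b q Δ H n N Δ≤ N≤)) ,
     -- Equality holds, as every level has exactly `n` vertices.
     ℚ.≤-reflexive (trans (cong ((c ^ℚ Δ) *ℚ_) (trans (cong ℕtoℚ size≡) (ℕtoℚ-* H n)))
                          (sym (ℚ.*-assoc (c ^ℚ Δ) (ℕtoℚ H) (ℕtoℚ n))))
  where
  -- This matches the bound `Δ ≤ (d + d) * q` at `d = 65536`, so that `c = 1 + 1 / 262144` satisfies
  -- `c ^ Δ ≤ 2 ^ q`.
  b = 65536 + 65536
  c = successor-ratio (b + b)
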